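{- For all $s,t,w\in\mathbb{N}$, there exists $\eta\in\mathbb{N}$ such that every graph with treewidth at most $w$ and with no $K_{s,t}$ subgraph is $(s+1)$-choosable with clustering $\eta$.
   Context: $\mathbb{N}=\{1,2,\dots\}$. Graphs are finite and may have loops and parallel edges; subgraphs are not required to be induced. Treewidth is the usual notion (minimum over tree decompositions of the maximum bag size minus 1). A color is an element of $\mathbb{Z}$. A list-assignment $L$ of a graph $G$ assigns to each vertex $v$ a non-empty set $L(v)$ of colors; it is an $\ell$-list-assignment if $|L(v)|\geq \ell$ for every $v\in V(G)$. An $L$-coloring of $G$ is a function $c$ on $V(G)$ with $c(v)\in L(v)$ for every $v$ (not necessarily proper). A monochromatic component with respect to $c$ is a connected component of the subgraph of $G$ induced by all the vertices assigned a single color. A coloring has clustering $\eta$ if every monochromatic component has at most $\eta$ vertices. $G$ is $\ell$-choosable with clustering $\eta$ if for every $\ell$-list-assignment $L$ of $G$ there is an $L$-coloring of $G$ with clustering $\eta$. -}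

module Defs where

open import Data.Fin using (Fin; toℕ; _↑ˡ_; _↑ʳ_; remQuot)
open import Data.Fin.Subset using (Subset; Nonempty; ∣_∣) renaming (_∈_ to _∈ˢ_)
open import Data.Integer using (ℤ)
open import Data.Nat using (ℕ; suc; _+_; _*_; _∸_; _⊔_; _≤_)
open import Data.Nat.DivMod using (_mod_)
open import Data.Product using (Σ-syntax; ∃-syntax; _×_; _,_; proj₁; proj₂)
open import Data.Sum using (_⊎_)
open import Data.Vec.Functional using (foldr)
open import Function.Bundles using (_⇔_)
open import Function.Definitions using (Injective)
open import Level using (0ℓ)
open import Relation.Binary.Construct.Closure.ReflexiveTransitive using (Star)
open import Relation.Binary.PropositionalEquality using (_≡_)
open import Relation.Nullary using (¬_)
open import Relation.Unary using (Pred; Satisfiable; U; _∈_)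

-- Finite undirected graphs; loops and parallel edges are allowed.  The order
-- of the two ends recorded for an edge carries no meaning: see Joins.
record Graph : Set where
  field
    order : ℕ
    size  : ℕ
    ends  : Fin size → Fin order × Fin order

  Vertex : Set
  Vertex = Fin order

  Edge : Set
  Edge = Fin size

  Joins : Edge → Vertex → Vertex → Set
  Joins e u v = (ends e ≡ (u , v)) ⊎ (ends e ≡ (v , u))

  Adjacent : Vertex → Vertex → Set
  Adjacent u v = ∃[ e ] Joins e u v

  -- Adjacency in the subgraph induced by P.
  AdjacentIn : Pred Vertex 0ℓ → Vertex → Vertex → Set
  AdjacentIn P u v = u ∈ P × v ∈ P × Adjacent u v

  -- For u and v in P: they are joined by a walk in the subgraph induced by P.
  -- (The walk of length zero is present even at vertices outside P.)
  WalkIn : Pred Vertex 0ℓ → Vertex → Vertex → Set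
  WalkIn P = Star (AdjacentIn P)

  -- The subgraph induced by P is non-empty and connected.
  ConnectedIn : Pred Vertex 0ℓ → Set
  ConnectedIn P = Satisfiable P × (∀ {u v} → u ∈ P → v ∈ P → WalkIn P u v)

  -- S is the vertex set of a connected component of the subgraph induced by P.
  IsComponentIn : Pred Vertex 0ℓ → Subset order → Set
  IsComponentIn P S =
    Nonempty S
    × (∀ {u} → u ∈ˢ S → u ∈ P)
    × (∀ {u} → u ∈ˢ S → ∀ v → v ∈ˢ S ⇔ WalkIn P u v)

open Graph using (Vertex; Edge)

-- H is isomorphic to a (not necessarily induced) subgraph of G.
record _⊑_ (H G : Graph) : Set where
  private
    module H = Graph H
    module G = Graph G
  field
    onVertices      : H.Vertex → G.Vertex
    onEdges         : H.Edge → G.Edge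
    onVertices-inj  : Injective _≡_ _≡_ onVertices
    onEdges-inj     : Injective _≡_ _≡_ onEdges
    preserves-ends  : ∀ e → G.Joins (onEdges e)
                        (onVertices (proj₁ (H.ends e)))
                        (onVertices (proj₂ (H.ends e)))

-- Complete bipartite graph: edges are indexed by Fin s × Fin t via remQuot.
K : ℕ → ℕ → Graph
K s t = record
  { order = s + t
  ; size  = s * t
  ; ends  = λ e → let (i , j) = remQuot {s} t e in (i ↑ˡ t) , (s ↑ʳ j)
  }

-- The cycle of length suc k: a loop for k = 0, a pair of parallel edges for
-- k = 1.
cycle : ℕ → Graph
cycle k = record
  { order = suc k
  ; size  = suc k
  ; ends  = λ i → i , (suc (toℕ i) mod suc k)
  }

IsTree : Graph → Set
IsTree T = Graph.ConnectedIn T U × (∀ k → ¬ (cycle k ⊑ T))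

record TreeDecomposition (G : Graph) : Set where
  private
    module G = Graph G
  field
    tree             : Graph
    isTree           : IsTree tree
    bag              : Vertex tree → Subset G.order
    edge-covered     : ∀ e → ∃[ x ] (proj₁ (G.ends e) ∈ˢ bag x
                                     × proj₂ (G.ends e) ∈ˢ bag x)
    vertex-connected : ∀ v → Graph.ConnectedIn tree (λ x → v ∈ˢ bag x)

  -- Truncated subtraction only affects the graph with no vertices, which gets
  -- width 0 rather than -1.
  width : ℕ
  width = foldr _⊔_ 0 (λ x → ∣ bag x ∣) ∸ 1

-- The minimum width of a tree decomposition of G is at most w.
Treewidth≤ : Graph → ℕ → Set
Treewidth≤ G w = Σ[ D ∈ TreeDecomposition G ] TreeDecomposition.width D ≤ w

Color : Set
Color = ℤ

record ListAssignment (G : Graph) : Set₁ where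
  field
    list     : Vertex G → Pred Color 0ℓ
    nonempty : ∀ v → Satisfiable (list v)

open ListAssignment

-- P has at least ℓ elements.  The injection goes into the ambient type, so
-- distinct membership proofs of one element are not counted separately.
AtLeast : {A : Set} → ℕ → Pred A 0ℓ → Set
AtLeast {A} ℓ P = Σ[ f ∈ (Fin ℓ → A) ] (Injective _≡_ _≡_ f × (∀ i → f i ∈ P))

IsListAssignmentOfSize : {G : Graph} → ℕ → ListAssignment G → Set
IsListAssignmentOfSize ℓ L = ∀ v → AtLeast ℓ (list L v)

IsColoring : {G : Graph} → ListAssignment G → (Vertex G → Color) → Set
IsColoring L c = ∀ v → c v ∈ list L v

IsMonochromaticComponent : (G : Graph) → (Vertex G → Color) →
                           Subset (Graph.order G) → Set
IsMonochromaticComponent G c S =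
  ∃[ a ] Graph.IsComponentIn G (λ v → c v ≡ a) S

HasClustering : (G : Graph) → (Vertex G → Color) → ℕ → Set
HasClustering G c η = ∀ S → IsMonochromaticComponent G c S → ∣ S ∣ ≤ η

ChoosableWithClustering : Graph → ℕ → ℕ → Set₁
ChoosableWithClustering G ℓ η =
  (L : ListAssignment G) → IsListAssignmentOfSize ℓ L →
  ∃[ c ] (IsColoring L c × HasClustering G c η)

{-# OPTIONS --safe #-}
module Submission where

-- Call a set of vertices closed if no monochromatic edge leaves it.  Colour the
-- vertices one at a time, letting each uncoloured vertex v discard the colours of
-- its coloured neighbours while these number fewer than s; at least two colours
-- stay available to v.  As K_{s,t} is no subgraph, only boundedly many vertices
-- have s or more neighbours in the coloured set Y.  Colouring all of these while
-- avoiding a colour a confines every a-coloured component meeting the old Y to the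
-- old Y; doing this for each colour on Y confines all components meeting Y to a
-- bounded set.  Repeating this lets Y grow.  As soon as |Y| exceeds a constant, a
-- bag of the tree decomposition separates the graph so that both sides contain
-- many vertices of Y, hence fewer than |Y|; colour the bag and recurse on the
-- two sides.  The bound on the size of the union of the components meeting Y is
-- linear in |Y| with a deduction that pays for the vertices of the bag, so that
-- it survives the splitting.

open import Data.Bool using (true; false)
open import Data.Fin using (Fin; zero; suc; toℕ; fromℕ; inject₁; inject≤; join; splitAt; remQuot; combine; _↑ˡ_; _↑ʳ_; _≟_)
open import Data.Fin.Properties using (any?; toℕ-injective; toℕ-fromℕ<; toℕ-fromℕ; toℕ-inject₁; toℕ<n; suc-injective; inject≤-injective; splitAt-↑ˡ; splitAt-↑ʳ; join-splitAt; combine-remQuot)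
open import Data.Fin.Relation.Unary.Top using (view; ‵fromℕ; ‵inject₁)
open import Data.Fin.Subset using (Subset; ∣_∣; _∩_; _∪_; ∁; ⁅_⁆) renaming (_∈_ to _∈ˢ_; _∉_ to _∉ˢ_; _⊆_ to _⊆ˢ_; ⊥ to ⊥ˢ; ⊤ to ⊤ˢ)
open import Data.Fin.Subset.Properties using (_∈?_; ∉⊥; ∈⊤; x∈⁅x⁆; x∈⁅y⁆⇒x≡y; x∈p∪q⁻; x∈p∪q⁺; x∈p∩q⁺; x∈p∩q⁻; x∉p⇒x∈∁p; x∈∁p⇒x∉p; ∩-distribʳ-∪; p⊆q⇒∣p∣≤∣q∣; p⊂q⇒∣p∣<∣q∣; ∣⊥∣≡0; ∣⁅x⁆∣≡1; ∣p∣≤n; ∣p∩q∣≤∣p∣; ∣p∩q∣≤∣q∣)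
open import Data.Integer using (ℤ; 0ℤ)
import Data.Integer as ℤ
open import Data.List using (List; []; _∷_; length; lookup; map; filter; tabulate; allFin)
open import Data.List.Membership.DecPropositional ℤ._≟_ using () renaming (_∈?_ to _∈ˡ?_)
open import Data.List.Membership.Propositional using (_∈_; _∉_)
open import Data.List.Membership.Propositional.Properties using (∈-lookup; ∈-map⁻; ∈-map⁺; ∈-filter⁻; ∈-filter⁺; ∈-allFin; ∈-tabulate⁻)
open import Data.List.Properties using (length-map; length-tabulate; filter-accept; filter-reject; filter-all)
open import Data.List.Relation.Unary.All as All using ([]; _∷_)
open import Data.List.Relation.Unary.AllPairs using ([]; _∷_)
open import Data.List.Relation.Unary.Any using (here; there)
open import Data.List.Relation.Unary.Unique.Propositional using (Unique)
import Data.List.Relation.Unary.Unique.Propositional.Properties as Unique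
open import Data.Nat using (ℕ; zero; suc; z≤n; s≤s; _+_; _*_; _^_; _∸_; _⊔_; _≤_; _<_; _≤?_; _<?_; NonZero; >-nonZero; >-nonZero⁻¹)
open import Data.Nat.DivMod using (_%_; _mod_; m<n⇒m%n≡m; n%n≡0)
import Data.Nat.Properties as ℕ
open import Data.Nat.Tactic.RingSolver using (solve-∀)
open import Data.Product using (∃-syntax; Σ-syntax; _×_; _,_; proj₁; proj₂)
open import Data.Product.Properties using (,-injective; ≡-dec)
open import Data.Sum using (_⊎_; inj₁; inj₂; swap; [_,_]′)
open import Data.Unit using (⊤; tt)
open import Data.Vec as Vec using ([]; _∷_)
open import Data.Vec.Functional using (foldr)
open import Data.Vec.Properties using (lookup∘tabulate; []=⇒lookup; lookup⇒[]=)
open import Function using (_∘_; Equivalence)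
open import Function.Definitions using (Injective)
open import Level using (0ℓ)
open import Relation.Binary.Construct.Closure.ReflexiveTransitive using (Star; ε; _◅_; _◅◅_) renaming (map to map-walk)
open import Relation.Binary.PropositionalEquality hiding (resp)
open import Relation.Nullary using (¬_; Dec; yes; no; does; contradiction)
open import Relation.Nullary.Decidable using (_⊎-dec_; _×-dec_; ¬?; dec-true)
open import Relation.Unary using (Pred; Decidable)
open import Defs

-- Edges of trees are bridges

suc-toℕ-mod-inject₁ : ∀ {k} (i : Fin k) → suc (toℕ (inject₁ i)) mod suc k ≡ suc i
suc-toℕ-mod-inject₁ {k} i = toℕ-injective (begin
  toℕ (suc (toℕ (inject₁ i)) mod suc k)   ≡⟨ toℕ-fromℕ< _ ⟩
  suc (toℕ (inject₁ i)) % suc k           ≡⟨ cong (λ m → suc m % suc k) (toℕ-inject₁ i) ⟩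
  suc (toℕ i) % suc k                     ≡⟨ m<n⇒m%n≡m (s≤s (toℕ<n i)) ⟩
  suc (toℕ i)                             ∎)
  where
  open ≡-Reasoning

suc-toℕ-mod-fromℕ : ∀ k → suc (toℕ (fromℕ k)) mod suc k ≡ zero
suc-toℕ-mod-fromℕ k = toℕ-injective (begin
  toℕ (suc (toℕ (fromℕ k)) mod suc k)   ≡⟨ toℕ-fromℕ< _ ⟩
  suc (toℕ (fromℕ k)) % suc k           ≡⟨ cong (λ m → suc m % suc k) (toℕ-fromℕ k) ⟩
  suc k % suc k                         ≡⟨ n%n≡0 (suc k) ⟩
  0                                     ∎)
  where
  open ≡-Reasoning

module Bridges (T : Graph) where
  open Graph T

  joins-ends : ∀ {e u v x y} → Joins e u v → Joins e x y →
               (u ≡ x × v ≡ y) ⊎ (u ≡ y × v ≡ x)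
  joins-ends (inj₁ p) (inj₁ q) = inj₁ (,-injective (trans (sym p) q))
  joins-ends (inj₁ p) (inj₂ q) = inj₂ (,-injective (trans (sym p) q))
  joins-ends (inj₂ p) (inj₁ q) with ,-injective (trans (sym p) q)
  ... | v≡x , u≡y = inj₂ (u≡y , v≡x)
  joins-ends (inj₂ p) (inj₂ q) with ,-injective (trans (sym p) q)
  ... | v≡y , u≡x = inj₁ (u≡x , v≡y)

  -- Only the edge `e` is deleted, not the pair of its ends, so a parallel edge still counts as a
  -- detour.
  AdjacentOff : Edge → Vertex → Vertex → Set
  AdjacentOff e u v = ∃[ f ] (f ≢ e × Joins f u v)

  data Path (e : Edge) : Vertex → Vertex → ℕ → Set
  at : ∀ {e x y k} → Path e x y k → Fin (suc k) → Vertex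

  -- The index counts the edges; the vertices of a path are distinct.
  data Path e where
    stay : ∀ x → Path e x x 0
    step : ∀ {x z y k} → AdjacentOff e x z → (p : Path e z y k) →
           (∀ i → at p i ≢ x) → Path e x y (suc k)

  at (stay x)           _       = x
  at (step {x} _ _ _)   zero    = x
  at (step _ p _)       (suc i) = at p i

  at-zero : ∀ {e x y k} (p : Path e x y k) → at p zero ≡ x
  at-zero (stay _)     = refl
  at-zero (step _ _ _) = refl

  at-last : ∀ {e x y k} (p : Path e x y k) → at p (fromℕ k) ≡ y
  at-last (stay _)     = refl
  at-last (step _ p _) = at-last p

  at-injective : ∀ {e x y k} (p : Path e x y k) {i j} → at p i ≡ at p j → i ≡ j
  at-injective (stay _)     {zero}  {zero}  _  = refl
  at-injective (step _ _ _) {zero}  {zero}  _  = refl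
  at-injective (step _ _ d) {zero}  {suc j} eq = contradiction (sym eq) (d j)
  at-injective (step _ _ d) {suc i} {zero}  eq = contradiction eq (d i)
  at-injective (step _ p _) {suc i} {suc j} eq = cong suc (at-injective p eq)

  via : ∀ {e x y k} (p : Path e x y k) (i : Fin k) →
        AdjacentOff e (at p (inject₁ i)) (at p (suc i))
  via (step (f , f≢e , j) p _) zero    = f , f≢e , subst (Joins f _) (sym (at-zero p)) j
  via (step _ p _)             (suc i) = via p i

  via-injective : ∀ {e x y k} (p : Path e x y k) {i j} →
                  proj₁ (via p i) ≡ proj₁ (via p j) → i ≡ j
  via-injective p {i} {j} eq
    with joins-ends (subst (λ f → Joins f _ _) eq (proj₂ (proj₂ (via p i))))
                    (proj₂ (proj₂ (via p j)))
  ... | inj₁ (_ , q) = suc-injective (at-injective p q)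
  -- Using one edge in opposite directions would make each of `i` and `j` the successor of the
  -- other.
  ... | inj₂ (q , r) = contradiction (trans i≡1+j (cong suc j≡1+i)) (ℕ.<⇒≢ (ℕ.m≤n⇒m≤1+n ℕ.≤-refl))
    where
    i≡1+j : toℕ i ≡ suc (toℕ j)
    i≡1+j = trans (sym (toℕ-inject₁ i)) (cong toℕ (at-injective p q))
    j≡1+i : toℕ j ≡ suc (toℕ i)
    j≡1+i = trans (sym (toℕ-inject₁ j)) (cong toℕ (sym (at-injective p r)))

  suffix : ∀ {e x y k} (p : Path e x y k) i → ∃[ l ] Path e (at p i) y l
  suffix (stay x)         _       = 0 , stay x
  suffix p@(step _ _ _)   zero    = _ , p
  suffix (step _ p _)     (suc i) = suffix p i

  -- Loop erasure: when the new first vertex already lies on the path, only the suffix from there is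
  -- kept.
  simplify : ∀ {e x y} → Star (AdjacentOff e) x y → ∃[ k ] Path e x y k
  simplify ε = 0 , stay _
  simplify {x = x} (a ◅ w) with simplify w
  ... | k , p with any? (λ i → at p i ≟ x)
  ...   | yes (i , refl) = suffix p i
  ...   | no  x∉p        = suc k , step a p (λ i eq → x∉p (i , eq))

  -- A detour off `e`, made simple and closed up by `e`, is a cycle. Loops and parallel edges need
  -- no separate treatment, since `cycle 0` and `cycle 1` cover them.
  bridge : (∀ k → ¬ (cycle k ⊑ T)) → ∀ {e x y} → Joins e x y → ¬ Star (AdjacentOff e) x y
  bridge acyclic {e} {x} {y} e∈xy w with simplify w
  ... | k , p = acyclic k record
    { onVertices     = at p
    ; onEdges        = edge
    ; onVertices-inj = at-injective p
    ; onEdges-inj    = edge-injective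
    ; preserves-ends = edge-joins
    }
    where
    edge : Fin (suc k) → Edge
    edge i with view i
    -- The last position receives `e`, which leads from `y` back to `x`.
    ... | ‵fromℕ     = e
    ... | ‵inject₁ j = proj₁ (via p j)

    edge-injective : ∀ {i j} → edge i ≡ edge j → i ≡ j
    edge-injective {i} {j} eq with view i | view j
    ... | ‵fromℕ     | ‵fromℕ     = refl
    ... | ‵fromℕ     | ‵inject₁ b = contradiction (sym eq) (proj₁ (proj₂ (via p b)))
    ... | ‵inject₁ a | ‵fromℕ     = contradiction eq (proj₁ (proj₂ (via p a)))
    ... | ‵inject₁ a | ‵inject₁ b = cong inject₁ (via-injective p eq)

    edge-joins : ∀ i → Joins (edge i) (at p i) (at p (suc (toℕ i) mod suc k))
    edge-joins i with view i
    ... | ‵fromℕ rewrite suc-toℕ-mod-fromℕ k | at-last p | at-zero p = swap e∈xy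
    ... | ‵inject₁ j rewrite suc-toℕ-mod-inject₁ j = proj₂ (proj₂ (via p j))

-- Separations from tree decompositions

-- Rooted trees with nodes in Fin m: d ◂ e hangs the root of e below the root of d.
data Rooted (m : ℕ) : Set where
  leaf : Fin m → Rooted m
  _◂_  : Rooted m → Rooted m → Rooted m

module _ {m : ℕ} where
  root : Rooted m → Fin m
  root (leaf x) = x
  root (d ◂ e)  = root d

  infix 4 _∈ʳ_ _∈ʳ?_
  _∈ʳ_ : Fin m → Rooted m → Set
  x ∈ʳ leaf y  = x ≡ y
  x ∈ʳ (d ◂ e) = x ∈ʳ d ⊎ x ∈ʳ e

  _∈ʳ?_ : ∀ x d → Dec (x ∈ʳ d)
  x ∈ʳ? leaf y  = x ≟ y
  x ∈ʳ? (d ◂ e) = (x ∈ʳ? d) ⊎-dec (x ∈ʳ? e)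

  root∈ : ∀ d → root d ∈ʳ d
  root∈ (leaf x) = refl
  root∈ (d ◂ e)  = inj₁ (root∈ d)

module Bags {m n : ℕ} (bag : Fin m → Subset n) where

  cover : Rooted m → Subset n
  cover (leaf x) = bag x
  cover (d ◂ e)  = cover d ∪ cover e

  ∈-cover⁻ : ∀ d {v} → v ∈ˢ cover d → ∃[ x ] (x ∈ʳ d × v ∈ˢ bag x)
  ∈-cover⁻ (leaf x) v∈ = x , refl , v∈
  ∈-cover⁻ (d ◂ e)  v∈ with x∈p∪q⁻ (cover d) (cover e) v∈
  ... | inj₁ v∈d = let x , x∈d , v∈x = ∈-cover⁻ d v∈d in x , inj₁ x∈d , v∈x
  ... | inj₂ v∈e = let x , x∈e , v∈x = ∈-cover⁻ e v∈e in x , inj₂ x∈e , v∈x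

  ∈-cover⁺ : ∀ d {v x} → x ∈ʳ d → v ∈ˢ bag x → v ∈ˢ cover d
  ∈-cover⁺ (leaf x) refl       v∈x = v∈x
  ∈-cover⁺ (d ◂ e)  (inj₁ x∈d) v∈x = x∈p∪q⁺ (inj₁ (∈-cover⁺ d x∈d v∈x))
  ∈-cover⁺ (d ◂ e)  (inj₂ x∈e) v∈x = x∈p∪q⁺ (inj₂ (∈-cover⁺ e x∈e v∈x))

  -- The trace of `vertex-connected` across the tree edge that hangs `root e` below `root d`.
  Valid : Rooted m → Set
  Valid (leaf x) = ⊤
  Valid (d ◂ e)  = Valid d × Valid e ×
    (∀ {v} → v ∈ˢ cover d → v ∈ˢ cover e → v ∈ˢ bag (root d) × v ∈ˢ bag (root e))

  -- The leaf `x` becomes `leaf x ◂ leaf y`, which keeps every root. A vertex of `bag y` that also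
  -- occurs across some higher edge is already covered, hence lies in `bag x`, and the old condition
  -- applies to it.
  insert : ∀ d {x} y → x ∈ʳ d → Valid d → (∀ {v} → v ∈ˢ bag y → v ∈ˢ cover d → v ∈ˢ bag x) →
           ∃[ d′ ] (Valid d′ × root d′ ≡ root d ×
                    (∀ {z} → z ∈ʳ d′ → z ∈ʳ d ⊎ z ≡ y) × (∀ {z} → z ∈ʳ d ⊎ z ≡ y → z ∈ʳ d′))
  insert (leaf x) y refl _ _ =
    leaf x ◂ leaf y , (tt , tt , _,_) , refl , (λ z∈ → z∈) , (λ z∈ → z∈)
  insert (d ◂ e) y (inj₁ x∈d) (vd , ve , sep) y-sep
    with insert d y x∈d vd (λ v∈y v∈d → y-sep v∈y (x∈p∪q⁺ (inj₁ v∈d)))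
  ... | d′ , vd′ , root-eq , to , from =
    d′ ◂ e , (vd′ , ve , sep′) , root-eq
    , (λ { (inj₁ z∈d′) → [ inj₁ ∘ inj₁ , inj₂ ]′ (to z∈d′) ; (inj₂ z∈e) → inj₁ (inj₂ z∈e) })
    , (λ { (inj₁ (inj₁ z∈d)) → inj₁ (from (inj₁ z∈d))
         ; (inj₁ (inj₂ z∈e)) → inj₂ z∈e
         ; (inj₂ z≡y)        → inj₁ (from (inj₂ z≡y)) })
    where
    sep′ : ∀ {v} → v ∈ˢ cover d′ → v ∈ˢ cover e → v ∈ˢ bag (root d′) × v ∈ˢ bag (root e)
    sep′ v∈d′ v∈e with ∈-cover⁻ d′ v∈d′
    ... | z , z∈d′ , v∈z rewrite root-eq with to z∈d′
    ...   | inj₁ z∈d  = sep (∈-cover⁺ d z∈d v∈z) v∈e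
    ...   | inj₂ refl = sep (∈-cover⁺ d x∈d (y-sep v∈z (x∈p∪q⁺ (inj₂ v∈e)))) v∈e
  insert (d ◂ e) y (inj₂ x∈e) (vd , ve , sep) y-sep
    with insert e y x∈e ve (λ v∈y v∈e → y-sep v∈y (x∈p∪q⁺ (inj₂ v∈e)))
  ... | e′ , ve′ , root-eq , to , from =
    d ◂ e′ , (vd , ve′ , sep′) , refl
    , (λ { (inj₁ z∈d) → inj₁ (inj₁ z∈d) ; (inj₂ z∈e′) → [ inj₁ ∘ inj₂ , inj₂ ]′ (to z∈e′) })
    , (λ { (inj₁ (inj₁ z∈d)) → inj₁ z∈d
         ; (inj₁ (inj₂ z∈e)) → inj₂ (from (inj₁ z∈e))
         ; (inj₂ z≡y)        → inj₂ (from (inj₂ z≡y)) })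
    where
    sep′ : ∀ {v} → v ∈ˢ cover d → v ∈ˢ cover e′ → v ∈ˢ bag (root d) × v ∈ˢ bag (root e′)
    sep′ v∈d v∈e′ with ∈-cover⁻ e′ v∈e′
    ... | z , z∈e′ , v∈z rewrite root-eq with to z∈e′
    ...   | inj₁ z∈e  = sep v∈d (∈-cover⁺ e z∈e v∈z)
    ...   | inj₂ refl = sep v∈d (∈-cover⁺ e x∈e (y-sep v∈z (x∈p∪q⁺ (inj₁ v∈d))))

module Exploration {G : Graph} (D : TreeDecomposition G) where
  open TreeDecomposition D
  open Bags bag
  open Graph tree
  open Bridges tree

  -- Connectivity is an invariant of the growth only: it closes the detour in `extend-sep`, and
  -- `rooted` forgets it.
  Explored : Rooted order → Set
  Explored d = Valid d × (∀ {a b} → a ∈ʳ d → b ∈ʳ d → WalkIn (_∈ʳ d) a b)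

  -- Otherwise a walk from y back to d through bags containing v, continued inside
  -- d to x, would bypass e, although every edge of a tree is a bridge.
  extend-sep : ∀ {d e x y} → Explored d → x ∈ʳ d → ¬ (y ∈ʳ d) → Joins e x y →
               ∀ {v} → v ∈ˢ bag y → v ∈ˢ cover d → v ∈ˢ bag x
  extend-sep {d} {e} {x} {y} (_ , conn) x∈d y∉d e∈xy {v} v∈y v∈d
    with ∈-cover⁻ d v∈d
  ... | z , z∈d , v∈z = search ε y∉d (proj₂ (vertex-connected v) v∈y v∈z)
    where
    inside-off : ∀ {a b} → AdjacentIn (_∈ʳ d) a b → AdjacentOff e a b
    inside-off (a∈d , b∈d , f , j) = f , f≢e , j
      where
      f≢e : f ≢ e
      f≢e refl with joins-ends e∈xy j
      ... | inj₁ (_ , refl) = y∉d b∈d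
      ... | inj₂ (_ , refl) = y∉d a∈d

    search : ∀ {a} → Star (AdjacentOff e) y a → ¬ (a ∈ʳ d) →
             WalkIn (λ q → v ∈ˢ bag q) a z → v ∈ˢ bag x
    search w a∉d ε = contradiction z∈d a∉d
    search w a∉d (_◅_ {j = b} (v∈a , v∈b , f , j) w′) with f ≟ e
    ... | yes refl with joins-ends e∈xy j
    ...   | inj₁ (refl , _) = v∈a
    ...   | inj₂ (refl , _) = v∈b
    search w a∉d (_◅_ {j = b} (v∈a , v∈b , f , j) w′) | no f≢e with b ∈ʳ? d
    ...   | no b∉d  = search (w ◅◅ (f , f≢e , j) ◅ ε) b∉d w′
    ...   | yes b∈d = contradiction
            (w ◅◅ (f , f≢e , j) ◅ map-walk inside-off (conn b∈d x∈d))
            (bridge (proj₂ isTree) (swap e∈xy))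

  extend : ∀ {d x y} → Explored d → x ∈ʳ d → Adjacent x y →
           ∃[ d′ ] (Explored d′ × (∀ {z} → z ∈ʳ d → z ∈ʳ d′) × y ∈ʳ d′)
  extend {d} {x} {y} ex x∈d (e , j) with y ∈ʳ? d
  ... | yes y∈d = d , ex , (λ z∈ → z∈) , y∈d
  ... | no  y∉d with insert d y x∈d (proj₁ ex) (extend-sep ex x∈d y∉d j)
  ...   | d′ , vd′ , _ , to , from = d′ , (vd′ , conn′) , from ∘ inj₁ , from (inj₂ refl)
    where
    widen : ∀ {a b} → AdjacentIn (_∈ʳ d) a b → AdjacentIn (_∈ʳ d′) a b
    widen (a∈ , b∈ , adj) = from (inj₁ a∈) , from (inj₁ b∈) , adj
    x∈d′ = from (inj₁ x∈d)
    y∈d′ = from (inj₂ refl)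
    conn′ : ∀ {a b} → a ∈ʳ d′ → b ∈ʳ d′ → WalkIn (_∈ʳ d′) a b
    conn′ a∈ b∈ with to a∈ | to b∈
    ... | inj₁ a∈d  | inj₁ b∈d  = map-walk widen (proj₂ ex a∈d b∈d)
    ... | inj₁ a∈d  | inj₂ refl = map-walk widen (proj₂ ex a∈d x∈d) ◅◅ (x∈d′ , y∈d′ , e , j) ◅ ε
    ... | inj₂ refl | inj₁ b∈d  = (y∈d′ , x∈d′ , e , swap j) ◅ map-walk widen (proj₂ ex x∈d b∈d)
    ... | inj₂ refl | inj₂ refl = ε

  reach : ∀ {d x y} → Explored d → x ∈ʳ d → WalkIn (λ _ → ⊤) x y →
          ∃[ d′ ] (Explored d′ × (∀ {z} → z ∈ʳ d → z ∈ʳ d′) × y ∈ʳ d′)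
  reach ex x∈d ε = _ , ex , (λ z∈ → z∈) , x∈d
  reach ex x∈d ((_ , _ , adj) ◅ w) =
    let _ , ex₁ , sub₁ , y∈d₁ = extend ex x∈d adj
        d₂ , ex₂ , sub₂ , z∈d₂ = reach ex₁ y∈d₁ w
    in d₂ , ex₂ , sub₂ ∘ sub₁ , z∈d₂

  reach-all : (ys : List Vertex) → ∃[ d ] (Explored d × (∀ {y} → y ∈ ys → y ∈ʳ d))
  reach-all [] with proj₁ (proj₁ isTree)
  ... | r , _ = leaf r , (tt , λ { refl refl → ε }) , λ ()
  reach-all (y ∷ ys) =
    let d , ex , sub = reach-all ys
        d′ , ex′ , sub′ , y∈d′ = reach ex (root∈ d) (proj₂ (proj₁ isTree) _ _)
    in d′ , ex′ , λ { (here refl) → y∈d′ ; (there z∈) → sub′ (sub z∈) }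

  rooted : ∃[ d ] (Valid d × (∀ x → x ∈ʳ d))
  rooted = let d , (v , _) , all = reach-all (allFin order) in d , v , λ x → all (∈-allFin x)

≤-foldr-⊔ : ∀ {m} (f : Fin m → ℕ) i → f i ≤ foldr _⊔_ 0 f
≤-foldr-⊔ f zero    = ℕ.m≤m⊔n _ _
≤-foldr-⊔ f (suc i) = ℕ.≤-trans (≤-foldr-⊔ (f ∘ suc) i) (ℕ.m≤n⊔m (f zero) _)

bag-size : ∀ {G} (D : TreeDecomposition G) {w} → TreeDecomposition.width D ≤ w →
           ∀ x → ∣ TreeDecomposition.bag D x ∣ ≤ suc w
bag-size D width≤w x =
  ℕ.≤-trans (≤-foldr-⊔ _ x) (ℕ.≤-trans (ℕ.m≤n+m∸n _ 1) (s≤s width≤w))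

∣p∪q∣+∣p∩q∣≡∣p∣+∣q∣ : ∀ {n} (p q : Subset n) → ∣ p ∪ q ∣ + ∣ p ∩ q ∣ ≡ ∣ p ∣ + ∣ q ∣
∣p∪q∣+∣p∩q∣≡∣p∣+∣q∣ []          []          = refl
∣p∪q∣+∣p∩q∣≡∣p∣+∣q∣ (true ∷ p)  (true ∷ q)  = cong suc (trans (ℕ.+-suc _ _)
  (trans (cong suc (∣p∪q∣+∣p∩q∣≡∣p∣+∣q∣ p q)) (sym (ℕ.+-suc _ _))))
∣p∪q∣+∣p∩q∣≡∣p∣+∣q∣ (true ∷ p)  (false ∷ q) = cong suc (∣p∪q∣+∣p∩q∣≡∣p∣+∣q∣ p q)
∣p∪q∣+∣p∩q∣≡∣p∣+∣q∣ (false ∷ p) (true ∷ q)  =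
  trans (cong suc (∣p∪q∣+∣p∩q∣≡∣p∣+∣q∣ p q)) (sym (ℕ.+-suc _ _))
∣p∪q∣+∣p∩q∣≡∣p∣+∣q∣ (false ∷ p) (false ∷ q) = ∣p∪q∣+∣p∩q∣≡∣p∣+∣q∣ p q

∣p∪q∣≤∣p∣+∣q∣ : ∀ {n} (p q : Subset n) → ∣ p ∪ q ∣ ≤ ∣ p ∣ + ∣ q ∣
∣p∪q∣≤∣p∣+∣q∣ p q = subst (∣ p ∪ q ∣ ≤_) (∣p∪q∣+∣p∩q∣≡∣p∣+∣q∣ p q) (ℕ.m≤m+n _ _)

-- The last two fields say that no edge joins left ∖ right to right ∖ left.
record Separation (G : Graph) : Set where
  open Graph G
  field
    left right : Subset order
    covers     : ∀ v → v ∈ˢ left ⊎ v ∈ˢ right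
    left-end   : ∀ {u v} → Adjacent u v → u ∈ˢ left → u ∉ˢ right → v ∈ˢ left
    right-end  : ∀ {u v} → Adjacent u v → u ∈ˢ right → u ∉ˢ left → v ∈ˢ right

module Separators {G : Graph} (D : TreeDecomposition G) {w : ℕ}
                  (width≤w : TreeDecomposition.width D ≤ w) where
  open Graph G
  open TreeDecomposition D
  open Bags bag
  open Exploration D

  -- The root bag is exempt because edges at its vertices may lie only in bags outside the subtree;
  -- this bag becomes the separator.
  EdgesIn : Rooted (Graph.order tree) → Set
  EdgesIn d = ∀ {u v} → Adjacent u v → u ∈ˢ cover d → u ∉ˢ bag (root d) →
              ∃[ x ] (x ∈ʳ d × u ∈ˢ bag x × v ∈ˢ bag x)

  -- A bag of the other half containing `u` would put `u` into both covers, hence by `Valid` into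
  -- the root bag of its own half. The same argument gives `edges-right`.
  edges-left : ∀ {d e} → Valid (d ◂ e) → EdgesIn (d ◂ e) → EdgesIn d
  edges-left {d} {e} (_ , _ , sep) edges uv u∈d u∉r with edges uv (x∈p∪q⁺ (inj₁ u∈d)) u∉r
  ... | x , inj₁ x∈d , bags       = x , x∈d , bags
  ... | x , inj₂ x∈e , u∈x , v∈x  =
    contradiction (proj₁ (sep u∈d (∈-cover⁺ e x∈e u∈x))) u∉r

  edges-right : ∀ {d e} → Valid (d ◂ e) → EdgesIn (d ◂ e) → EdgesIn e
  edges-right {d} {e} (_ , _ , sep) edges uv u∈e u∉r
    with edges uv (x∈p∪q⁺ (inj₂ u∈e)) (λ u∈r → u∉r (proj₂ (sep (∈-cover⁺ d (root∈ d) u∈r) u∈e)))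
  ... | x , inj₂ x∈e , bags       = x , x∈e , bags
  ... | x , inj₁ x∈d , u∈x , v∈x  =
    contradiction (proj₂ (sep (∈-cover⁺ d x∈d u∈x) u∈e)) u∉r

  -- Take a lowest such subtree: its two halves each contain at most p vertices of Y.
  subtree : ∀ {p} → suc w ≤ p → (Y : Subset order) → ∀ d → Valid d → EdgesIn d →
            p < ∣ cover d ∩ Y ∣ →
            ∃[ e ] (EdgesIn e × p < ∣ cover e ∩ Y ∣ × ∣ cover e ∩ Y ∣ ≤ p + p)
  -- A single bag has at most `suc w ≤ p` vertices, so it cannot contain more than `p` vertices of
  -- `Y`.
  subtree w<p Y (leaf x) _ _ p< = contradiction
    (ℕ.≤-trans (∣p∩q∣≤∣p∣ (bag x) Y) (ℕ.≤-trans (bag-size D width≤w x) w<p)) (ℕ.<⇒≱ p<)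
  subtree {p} w<p Y (d ◂ e) valid edges p< with p <? ∣ cover d ∩ Y ∣ | p <? ∣ cover e ∩ Y ∣
  ... | yes p<d | _       = subtree w<p Y d (proj₁ valid) (edges-left {d} {e} valid edges) p<d
  ... | no  _   | yes p<e = subtree w<p Y e (proj₁ (proj₂ valid)) (edges-right {d} {e} valid edges) p<e
  ... | no  p≮d | no  p≮e = d ◂ e , edges , p< , (begin
    ∣ (cover d ∪ cover e) ∩ Y ∣          ≡⟨ cong ∣_∣ (∩-distribʳ-∪ Y (cover d) (cover e)) ⟩
    ∣ cover d ∩ Y ∪ cover e ∩ Y ∣        ≤⟨ ∣p∪q∣≤∣p∣+∣q∣ (cover d ∩ Y) (cover e ∩ Y) ⟩
    ∣ cover d ∩ Y ∣ + ∣ cover e ∩ Y ∣    ≤⟨ ℕ.+-mono-≤ (ℕ.≮⇒≥ p≮d) (ℕ.≮⇒≥ p≮e) ⟩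
    p + p                                ∎)
    where open ℕ.≤-Reasoning

  -- One side is the cover found by `subtree`, the other its complement together with the root bag.
  -- The first takes at most `2p` of the more than `3p` vertices of `Y`, which leaves more than `p`
  -- for the second.
  separation : ∀ {p} → suc w ≤ p → (Y : Subset order) → p + (p + p) < ∣ Y ∣ →
               Σ[ S ∈ Separation G ] let open Separation S in
                 ∣ left ∩ right ∣ ≤ suc w × p < ∣ Y ∩ left ∣ × p < ∣ Y ∩ right ∣
  separation {p} w<p Y 3p<Y
    with rooted
  ... | d , valid , all with subtree w<p Y d valid all-edges p<all
    where
    bag-of : ∀ {u v} → Adjacent u v → ∃[ x ] (x ∈ʳ d × u ∈ˢ bag x × v ∈ˢ bag x)
    bag-of (e , inj₁ refl) = let x , u∈ , v∈ = edge-covered e in x , all x , u∈ , v∈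
    bag-of (e , inj₂ refl) = let x , v∈ , u∈ = edge-covered e in x , all x , u∈ , v∈
    all-edges : EdgesIn d
    all-edges uv _ _ = bag-of uv
    Y⊆ : Y ⊆ˢ cover d ∩ Y
    Y⊆ {v} v∈Y = let x , v∈x = proj₁ (vertex-connected v) in
      x∈p∩q⁺ (∈-cover⁺ d (all x) v∈x , v∈Y)
    p<all : p < ∣ cover d ∩ Y ∣
    p<all = ℕ.<-≤-trans (ℕ.≤-<-trans (ℕ.m≤m+n p _) 3p<Y) (p⊆q⇒∣p∣≤∣q∣ Y⊆)
  ... | e , edges , p<e , e≤2p = record
    { left      = A
    ; right     = B
    ; covers    = covers
    ; left-end  = left-end
    ; right-end = right-end
    } , ℕ.≤-trans (p⊆q⇒∣p∣≤∣q∣ A∩B⊆X) (bag-size D width≤w (root e))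
      , ℕ.<-≤-trans p<e (p⊆q⇒∣p∣≤∣q∣ (λ v∈ → let v∈A , v∈Y = x∈p∩q⁻ A Y v∈ in x∈p∩q⁺ (v∈Y , v∈A)))
      , ℕ.+-cancelʳ-< (p + p) p _ (begin-strict
          p + (p + p)                       <⟨ 3p<Y ⟩
          ∣ Y ∣                             ≤⟨ p⊆q⇒∣p∣≤∣q∣ Y⊆ ⟩
          ∣ Y ∩ B ∪ A ∩ Y ∣                 ≤⟨ ∣p∪q∣≤∣p∣+∣q∣ (Y ∩ B) (A ∩ Y) ⟩
          ∣ Y ∩ B ∣ + ∣ A ∩ Y ∣             ≤⟨ ℕ.+-monoʳ-≤ ∣ Y ∩ B ∣ e≤2p ⟩
          ∣ Y ∩ B ∣ + (p + p)               ∎)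
    where
    open ℕ.≤-Reasoning
    A = cover e
    X = bag (root e)
    B = ∁ A ∪ X
    covers : ∀ v → v ∈ˢ A ⊎ v ∈ˢ B
    covers v with v ∈? A
    ... | yes v∈A = inj₁ v∈A
    ... | no  v∉A = inj₂ (x∈p∪q⁺ (inj₁ (x∉p⇒x∈∁p v∉A)))
    inner : ∀ {u v} → Adjacent u v → u ∈ˢ A → u ∉ˢ X → v ∈ˢ A
    inner uv u∈A u∉X = let x , x∈e , _ , v∈x = edges uv u∈A u∉X in ∈-cover⁺ e x∈e v∈x
    left-end : ∀ {u v} → Adjacent u v → u ∈ˢ A → u ∉ˢ B → v ∈ˢ A
    left-end uv u∈A u∉B = inner uv u∈A (λ u∈X → u∉B (x∈p∪q⁺ (inj₂ u∈X)))
    right-end : ∀ {u v} → Adjacent u v → u ∈ˢ B → u ∉ˢ A → v ∈ˢ B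
    right-end {v = v} (f , j) u∈B u∉A with v ∈? A | v ∈? X
    ... | no  v∉A | _       = x∈p∪q⁺ (inj₁ (x∉p⇒x∈∁p v∉A))
    ... | yes _   | yes v∈X = x∈p∪q⁺ (inj₂ v∈X)
    ... | yes v∈A | no  v∉X = contradiction (inner (f , swap j) v∈A v∉X) u∉A
    A∩B⊆X : A ∩ B ⊆ˢ X
    A∩B⊆X v∈ with x∈p∩q⁻ A B v∈
    ... | v∈A , v∈B with x∈p∪q⁻ (∁ A) X v∈B
    ...   | inj₁ v∈∁A = contradiction v∈A (x∈∁p⇒x∉p v∈∁A)
    ...   | inj₂ v∈X  = v∈X
    Y⊆ : Y ⊆ˢ Y ∩ B ∪ A ∩ Y
    Y⊆ {v} v∈Y with covers v
    ... | inj₁ v∈A = x∈p∪q⁺ (inj₂ (x∈p∩q⁺ (v∈A , v∈Y)))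
    ... | inj₂ v∈B = x∈p∪q⁺ (inj₁ (x∈p∩q⁺ (v∈Y , v∈B)))

-- Common neighbours in graphs without K_{s,t}

lookup-injective : ∀ {A : Set} {xs : List A} → Unique xs → Injective _≡_ _≡_ (lookup xs)
lookup-injective (_ ∷ _)  {zero}  {zero}  _  = refl
lookup-injective {xs = _ ∷ xs} (x∉ ∷ _) {zero}  {suc j} eq =
  contradiction eq (All.lookup x∉ (∈-lookup {xs = xs} j))
lookup-injective {xs = _ ∷ xs} (x∉ ∷ _) {suc i} {zero}  eq =
  contradiction (sym eq) (All.lookup x∉ (∈-lookup {xs = xs} i))
lookup-injective (_ ∷ u)  {suc i} {suc j} eq = cong suc (lookup-injective u eq)

length-filter-split : ∀ {A : Set} {P : Pred A 0ℓ} (P? : Decidable P) xs →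
                      length (filter P? xs) + length (filter (¬? ∘ P?) xs) ≡ length xs
length-filter-split P? [] = refl
length-filter-split P? (x ∷ xs) with P? x
... | yes _ = cong suc (length-filter-split P? xs)
... | no  _ = trans (ℕ.+-suc _ _) (cong suc (length-filter-split P? xs))

length-filter-map : ∀ {A B : Set} {P : Pred B 0ℓ} (P? : Decidable P) (f : A → B) xs →
                    length (filter P? (map f xs)) ≡ length (filter (P? ∘ f) xs)
length-filter-map P? f [] = refl
length-filter-map P? f (x ∷ xs) with P? (f x)
... | yes _ = cong suc (length-filter-map P? f xs)
... | no  _ = length-filter-map P? f xs

subset : ∀ {n} {P : Pred (Fin n) 0ℓ} → Decidable P → Subset n
subset P? = Vec.tabulate (does ∘ P?)

module _ {n} {P : Pred (Fin n) 0ℓ} (P? : Decidable P) where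

  ∈-subset⁺ : ∀ {v} → P v → v ∈ˢ subset P?
  ∈-subset⁺ {v} pv = lookup⇒[]= v _ (trans (lookup∘tabulate _ v) (dec-true (P? v) pv))

  ∈-subset⁻ : ∀ {v} → v ∈ˢ subset P? → P v
  ∈-subset⁻ {v} v∈ with P? v | trans (sym (lookup∘tabulate (does ∘ P?) v)) ([]=⇒lookup v∈)
  ... | yes pv | _ = pv

elements : ∀ {n} → Subset n → List (Fin n)
elements []          = []
elements (true ∷ p)  = zero ∷ map suc (elements p)
elements (false ∷ p) = map suc (elements p)

length-elements : ∀ {n} (p : Subset n) → length (elements p) ≡ ∣ p ∣
length-elements []          = refl
length-elements (true ∷ p)  = cong suc (trans (length-map suc (elements p)) (length-elements p))
length-elements (false ∷ p) = trans (length-map suc (elements p)) (length-elements p)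

∈-elements⁺ : ∀ {n} {p : Subset n} {v} → v ∈ˢ p → v ∈ elements p
∈-elements⁺ {p = true ∷ p}  Vec.here       = here refl
∈-elements⁺ {p = true ∷ p}  (Vec.there v∈) = there (∈-map⁺ suc (∈-elements⁺ v∈))
∈-elements⁺ {p = false ∷ p} (Vec.there v∈) = ∈-map⁺ suc (∈-elements⁺ v∈)

∈-elements⁻ : ∀ {n} {p : Subset n} {v} → v ∈ elements p → v ∈ˢ p
∈-elements⁻ {p = true ∷ p} (here refl) = Vec.here
∈-elements⁻ {p = true ∷ p} (there v∈) with ∈-map⁻ suc v∈
... | _ , u∈ , refl = Vec.there (∈-elements⁻ u∈)
∈-elements⁻ {p = false ∷ p} v∈ with ∈-map⁻ suc v∈
... | _ , u∈ , refl = Vec.there (∈-elements⁻ u∈)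

elements-unique : ∀ {n} (p : Subset n) → Unique (elements p)
elements-unique []          = []
elements-unique (false ∷ p) = Unique.map⁺ suc-injective (elements-unique p)
elements-unique (true ∷ p)  =
  All.tabulate (λ v∈ 0≡v → 0∉ (subst (_∈ _) (sym 0≡v) v∈)) ∷ Unique.map⁺ suc-injective (elements-unique p)
  where
  0∉ : ¬ (zero ∈ map suc (elements p))
  0∉ 0∈ with ∈-map⁻ suc 0∈
  ... | _ , _ , ()

length-filter-elements : ∀ {n} {P : Pred (Fin n) 0ℓ} (P? : Decidable P) (p : Subset n) →
                         length (filter P? (elements p)) ≡ ∣ subset P? ∩ p ∣
length-filter-elements P? [] = refl
length-filter-elements P? (true ∷ p) with P? zero
... | yes _ = cong suc (trans (length-filter-map P? suc (elements p)) (length-filter-elements (P? ∘ suc) p))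
... | no  _ = trans (length-filter-map P? suc (elements p)) (length-filter-elements (P? ∘ suc) p)
length-filter-elements P? (false ∷ p) with P? zero
... | yes _ = trans (length-filter-map P? suc (elements p)) (length-filter-elements (P? ∘ suc) p)
... | no  _ = trans (length-filter-map P? suc (elements p)) (length-filter-elements (P? ∘ suc) p)

<-split : ∀ {t m a b} → t * 2 ^ suc m < a + b → t * 2 ^ m < a ⊎ t * 2 ^ m < b
<-split {t} {m} {a} {b} lt with t * 2 ^ m <? a | t * 2 ^ m <? b
... | yes l | _     = inj₁ l
... | no  _ | yes l = inj₂ l
... | no ¬l | no ¬r = contradiction lt (ℕ.≤⇒≯ (begin
  a + b                    ≤⟨ ℕ.+-mono-≤ (ℕ.≮⇒≥ ¬l) (ℕ.≮⇒≥ ¬r) ⟩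
  t * 2 ^ m + t * 2 ^ m    ≡⟨ ℕ.*-distribˡ-+ t (2 ^ m) (2 ^ m) ⟨
  t * (2 ^ m + 2 ^ m)      ≡⟨ cong (λ k → t * (2 ^ m + k)) (ℕ.+-identityʳ (2 ^ m)) ⟨
  t * 2 ^ suc m            ∎))
  where open ℕ.≤-Reasoning

module _ {A B : Set} {R : A → B → Set} (R? : ∀ a b → Dec (R a b)) where

  record Biclique (s t : ℕ) (bs : List B) (as : List A) : Set where
    field
      small     : Fin s → B
      large     : Fin t → A
      small-inj : Injective _≡_ _≡_ small
      large-inj : Injective _≡_ _≡_ large
      small∈    : ∀ i → small i ∈ bs
      large∈    : ∀ j → large j ∈ as
      related   : ∀ i j → R (large j) (small i)

  -- Induction on `bs` replaces a pigeonhole count over `s`-subsets. The head `b` splits `as` into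
  -- related and unrelated elements, and one class exceeds half the bound. If it is the related
  -- class, `b` joins the small side and `s` drops by one; otherwise `b` is dropped and no degree
  -- changes.
  biclique : ∀ s t bs as → Unique bs → Unique as →
             (∀ {a} → a ∈ as → s ≤ length (filter (R? a) bs)) →
             t * 2 ^ length bs < length as → Biclique s t bs as
  biclique zero t bs as _ uas _ big = record
    { small     = λ ()
    ; large     = λ j → lookup as (inject≤ j t≤)
    ; small-inj = λ { {()} }
    ; large-inj = λ eq → inject≤-injective t≤ t≤ _ _ (lookup-injective uas eq)
    ; small∈    = λ ()
    ; large∈    = λ j → ∈-lookup {xs = as} (inject≤ j t≤)
    ; related   = λ ()
    }
    where
    t≤ : t ≤ length as
    t≤ = ℕ.≤-trans (ℕ.m≤m*n t (2 ^ length bs) {{ℕ.m^n≢0 2 (length bs)}}) (ℕ.<⇒≤ big)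
  -- The strict bound makes `as` non-empty, even for `t = 0`.
  biclique (suc s) t [] (a ∷ as) _ _ deg _ with deg (here refl)
  ... | ()
  biclique (suc s) t (b ∷ bs) as ubs@(b∉ ∷ ubs′) uas deg big
    with <-split {t} {length bs} (subst (t * 2 ^ suc (length bs) <_)
                          (sym (length-filter-split (λ a → R? a b) as)) big)
  ... | inj₂ big₂ = record
    { small     = small
    ; large     = large
    ; small-inj = small-inj
    ; large-inj = large-inj
    ; small∈    = there ∘ small∈
    ; large∈    = proj₁ ∘ ∈-filter⁻ _ {xs = as} ∘ large∈
    ; related   = related
    }
    where
    deg₂ : ∀ {a} → a ∈ filter (λ a → ¬? (R? a b)) as → suc s ≤ length (filter (R? a) bs)
    deg₂ {a} a∈ with ∈-filter⁻ (λ a → ¬? (R? a b)) {xs = as} a∈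
    ... | a∈as , ¬Rab = subst (suc s ≤_) (cong length (filter-reject (R? a) ¬Rab)) (deg a∈as)
    open Biclique (biclique (suc s) t bs _ ubs′ (Unique.filter⁺ _ uas) deg₂ big₂)
  ... | inj₁ big₁ = record
    { small     = λ { zero → b ; (suc i) → small i }
    ; large     = large
    ; small-inj = λ
      { {zero}  {zero}  _  → refl
      ; {zero}  {suc j} eq → contradiction eq (All.lookup b∉ (small∈ j))
      ; {suc i} {zero}  eq → contradiction (sym eq) (All.lookup b∉ (small∈ i))
      ; {suc i} {suc j} eq → cong suc (small-inj eq)
      }
    ; large-inj = large-inj
    ; small∈    = λ { zero → here refl ; (suc i) → there (small∈ i) }
    ; large∈    = proj₁ ∘ ∈-filter⁻ _ {xs = as} ∘ large∈
    ; related   = λ { zero    j → proj₂ (∈-filter⁻ (λ a → R? a b) {xs = as} (large∈ j))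
                    ; (suc i) j → related i j }
    }
    where
    deg₁ : ∀ {a} → a ∈ filter (λ a → R? a b) as → s ≤ length (filter (R? a) bs)
    deg₁ {a} a∈ with ∈-filter⁻ (λ a → R? a b) {xs = as} a∈
    ... | a∈as , Rab = ℕ.≤-pred (subst (suc s ≤_) (cong length (filter-accept (R? a) Rab)) (deg a∈as))
    open Biclique (biclique s t bs _ ubs′ (Unique.filter⁺ _ uas) deg₁ big₁)

module Neighbourhoods (G : Graph) where
  open Graph G
  open Bridges G using (joins-ends)

  adjacent-sym : ∀ {u v} → Adjacent u v → Adjacent v u
  adjacent-sym (e , j) = e , swap j

  adjacent? : ∀ u v → Dec (Adjacent u v)
  adjacent? u v = any? (λ e → (ends e ≟₂ (u , v)) ⊎-dec (ends e ≟₂ (v , u)))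
    where _≟₂_ = ≡-dec _≟_ _≟_

  N : Vertex → Subset order
  N v = subset (adjacent? v)

  -- Disjointness keeps the vertex map injective across the two sides and rules out one edge serving
  -- two pairs with its ends exchanged.
  K⊑ : ∀ {s t ys ws} → Biclique adjacent? s t ys ws → (∀ {v} → v ∈ ys → ¬ (v ∈ ws)) → K s t ⊑ G
  K⊑ {s} {t} bc disjoint = record
    { onVertices     = place ∘ splitAt s
    ; onEdges        = edge
    ; onVertices-inj = λ {a} {b} eq → trans (sym (join-splitAt s t a))
        (trans (cong (join s t) (place-inj (splitAt s a) (splitAt s b) eq)) (join-splitAt s t b))
    ; onEdges-inj    = edge-inj
    ; preserves-ends = preserves
    }
    where
    open Biclique bc
    place : Fin s ⊎ Fin t → Vertex
    place = [ small , large ]′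

    place-inj : ∀ a b → place a ≡ place b → a ≡ b
    place-inj (inj₁ i) (inj₁ j) eq = cong inj₁ (small-inj eq)
    place-inj (inj₁ i) (inj₂ j) eq = contradiction (subst (_∈ _) (sym eq) (large∈ j)) (disjoint (small∈ i))
    place-inj (inj₂ i) (inj₁ j) eq = contradiction (subst (_∈ _) eq (large∈ i)) (disjoint (small∈ j))
    place-inj (inj₂ i) (inj₂ j) eq = cong inj₂ (large-inj eq)

    edge : Fin (s * t) → Edge
    edge e = let i , j = remQuot {s} t e in proj₁ (related i j)

    joins : ∀ e → let i , j = remQuot {s} t e in Joins (edge e) (small i) (large j)
    joins e = let i , j = remQuot {s} t e in swap (proj₂ (related i j))

    edge-inj : Injective _≡_ _≡_ edge
    edge-inj {a} {b} eq with joins-ends (joins a) (subst (λ e → Joins e _ _) (sym eq) (joins b))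
    ... | inj₁ (p , q) = trans (sym (combine-remQuot {s} t a))
                               (trans (cong₂ combine (small-inj p) (large-inj q)) (combine-remQuot {s} t b))
    ... | inj₂ (p , _) = contradiction (subst (_∈ _) (sym p) (large∈ _)) (disjoint (small∈ _))

    preserves : ∀ e → let i , j = remQuot {s} t e in
                Joins (edge e) (place (splitAt s (i ↑ˡ t))) (place (splitAt s (s ↑ʳ j)))
    preserves e with joins e
    ... | j rewrite splitAt-↑ˡ s (proj₁ (remQuot {s} t e)) t
                  | splitAt-↑ʳ s t (proj₂ (remQuot {s} t e)) = j

  -- A longer list would contain the large side of a biclique whose `s` small vertices lie in `Y`.
  few-common-neighbours : ∀ {s t} → ¬ (K s t ⊑ G) → ∀ (Y : Subset order) {ws} → Unique ws →
                          (∀ {v} → v ∈ ws → v ∉ˢ Y × s ≤ ∣ N v ∩ Y ∣) →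
                          length ws ≤ t * 2 ^ ∣ Y ∣
  few-common-neighbours {s} {t} K⋢G Y {ws} uws heavy = ℕ.≮⇒≥ λ big → K⋢G (K⊑
    (biclique adjacent? s t (elements Y) ws (elements-unique Y) uws
      (λ {v} v∈ → subst (s ≤_) (sym (length-filter-elements (adjacent? v) Y)) (proj₂ (heavy v∈)))
      (subst (λ m → t * 2 ^ m < length ws) (sym (length-elements Y)) big))
    (λ v∈Y v∈ws → proj₁ (heavy v∈ws) (∈-elements⁻ v∈Y)))

-- Partial colourings

remove : ℤ → List ℤ → List ℤ
remove a = filter (λ b → ¬? (b ℤ.≟ a))

length-remove : ∀ a {xs} → Unique xs → length xs ≤ suc (length (remove a xs))
length-remove a [] = z≤n
length-remove a {x ∷ xs} (x∉ ∷ uxs) with x ℤ.≟ a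
... | no  _    = s≤s (length-remove a uxs)
... | yes refl = s≤s (ℕ.≤-reflexive (cong length (sym
                   (filter-all _ (All.map (λ x≢y y≡x → x≢y (sym y≡x)) x∉)))))

choose-other : ∀ a {xs} → Unique xs → 2 ≤ length xs → ∃[ b ] (b ∈ xs × b ≢ a)
choose-other a {x ∷ y ∷ _} ((x≢y ∷ _) ∷ _) _ with x ℤ.≟ a
... | no  x≢a  = x , here refl , x≢a
... | yes refl = y , there (here refl) , λ y≡x → x≢y (sym y≡x)
choose-other a {_ ∷ []} _ (s≤s ())

module Growth (t : ℕ) where

  -- Bounds the size of a set of `n` vertices once all outer vertices with at least `s` neighbours
  -- in it have been added; compare `few-common-neighbours`.
  growth : ℕ → ℕ
  growth n = n + t * 2 ^ n

  growths : ℕ → ℕ → ℕ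
  growths zero    n = n
  growths (suc j) n = growths j (growth n)

  growth-mono : ∀ {m n} → m ≤ n → growth m ≤ growth n
  growth-mono m≤n = ℕ.+-mono-≤ m≤n (ℕ.*-monoʳ-≤ t (ℕ.^-monoʳ-≤ 2 m≤n))

  growths-mono : ∀ {i j m n} → i ≤ j → m ≤ n → growths i m ≤ growths j n
  growths-mono {j = zero}  z≤n m≤n = m≤n
  growths-mono {j = suc j} z≤n m≤n =
    growths-mono {j = j} z≤n (ℕ.≤-trans m≤n (ℕ.m≤m+n _ _))
  growths-mono (s≤s i≤j) m≤n = growths-mono i≤j (growth-mono m≤n)

module Colourings (G : Graph) (s : ℕ) where
  open Graph G hiding (size)
  open Neighbourhoods G

  degree : Subset order → Vertex → ℕ
  degree Y v = ∣ N v ∩ Y ∣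

  degree-mono : ∀ {Y Y′ v} → Y ⊆ˢ Y′ → degree Y v ≤ degree Y′ v
  degree-mono {Y} {Y′} {v} Y⊆ = p⊆q⇒∣p∣≤∣q∣ λ u∈ →
    let u∈N , u∈Y = x∈p∩q⁻ (N v) Y u∈ in x∈p∩q⁺ (u∈N , Y⊆ u∈Y)

  -- A partial colouring of the region R: the vertices of Y are coloured, and a
  -- vertex v of R ∖ Y may still choose from avail v.  The colours of the
  -- coloured neighbours of v are discarded as long as there are fewer than s of
  -- them; of the s + 1 original colours, at least two then remain.
  record State (R : Subset order) : Set where
    field
      Y        : Subset order
      avail    : Vertex → List ℤ
      Y⊆R      : Y ⊆ˢ R
      unique   : ∀ v → Unique (avail v)
      coloured : ∀ {v} → v ∈ˢ Y → ∃[ a ] avail v ≡ a ∷ []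
      choice   : ∀ {v} → v ∈ˢ R → v ∉ˢ Y → 2 ≤ length (avail v)
      light    : ∀ {v} → v ∈ˢ R → v ∉ˢ Y → degree Y v < s → s < degree Y v + length (avail v)
      avoids   : ∀ {v u a} → v ∈ˢ R → v ∉ˢ Y → degree Y v < s →
                 u ∈ˢ Y → Adjacent v u → a ∈ avail u → a ∉ avail v

  open State

  one-colour : ∀ {R} (S : State R) {v a b} → v ∈ˢ Y S → a ∈ avail S v → b ∈ avail S v → a ≡ b
  one-colour S {v} v∈Y a∈v b∈v with avail S v | coloured S v∈Y | a∈v | b∈v
  ... | _ | _ , refl | here a≡x | here b≡x = trans a≡x (sym b≡x)

  infix 4 _≼_
  _≼_ : ∀ {R} → State R → State R → Set
  S ≼ S′ = Y S ⊆ˢ Y S′ × (∀ {v a} → a ∈ avail S′ v → a ∈ avail S v)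

  ≼-refl : ∀ {R} {S : State R} → S ≼ S
  ≼-refl = (λ v∈ → v∈) , λ a∈ → a∈

  ≼-trans : ∀ {R} {S S′ S″ : State R} → S ≼ S′ → S′ ≼ S″ → S ≼ S″
  ≼-trans (Y⊆ , a⊆) (Y⊆′ , a⊆′) = (λ v∈ → Y⊆′ (Y⊆ v∈)) , λ a∈ → a⊆ (a⊆′ a∈)

  module Add {R} (S : State R) {x} (x∈R : x ∈ˢ R) (x∉Y : x ∉ˢ Y S)
             {a} (a∈x : a ∈ avail S x) where

    Y⁺ : Subset order
    Y⁺ = ⁅ x ⁆ ∪ Y S

    -- The degree already counts `x`: on gaining its `s`-th coloured neighbour a vertex stops
    -- discarding, and so keeps the two or more colours it had left.
    Loses : Vertex → Set
    Loses v = v ∉ˢ Y S × Adjacent v x × degree Y⁺ v < s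

    loses? : ∀ v → Dec (Loses v)
    loses? v = ¬? (v ∈? Y S) ×-dec adjacent? v x ×-dec (degree Y⁺ v <? s)

    avail⁺ : Vertex → List ℤ
    avail⁺ v with v ≟ x | loses? v
    ... | yes _ | _     = a ∷ []
    ... | no _  | yes _ = remove a (avail S v)
    ... | no _  | no _  = avail S v

    Y⊆Y⁺ : Y S ⊆ˢ Y⁺
    Y⊆Y⁺ v∈ = x∈p∪q⁺ (inj₂ v∈)

    x∈Y⁺ : x ∈ˢ Y⁺
    x∈Y⁺ = x∈p∪q⁺ (inj₁ (x∈⁅x⁆ x))

    ∈Y⁺⁻ : ∀ {v} → v ∈ˢ Y⁺ → v ≡ x ⊎ v ∈ˢ Y S
    ∈Y⁺⁻ v∈ with x∈p∪q⁻ ⁅ x ⁆ (Y S) v∈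
    ... | inj₁ v∈x = inj₁ (x∈⁅y⁆⇒x≡y x v∈x)
    ... | inj₂ v∈Y = inj₂ v∈Y

    avail⁺-x : avail⁺ x ≡ a ∷ []
    avail⁺-x with x ≟ x
    ... | yes _  = refl
    ... | no x≢x = contradiction refl x≢x

    avail⁺⊆ : ∀ {v b} → b ∈ avail⁺ v → b ∈ avail S v
    avail⁺⊆ {v} b∈ with v ≟ x | loses? v
    avail⁺⊆ (here refl) | yes refl | _ = a∈x
    avail⁺⊆ {v} b∈ | no _ | yes _ = proj₁ (∈-filter⁻ _ {xs = avail S v} b∈)
    avail⁺⊆     b∈ | no _ | no  _ = b∈

    unique⁺ : ∀ v → Unique (avail⁺ v)
    unique⁺ v with v ≟ x | loses? v
    ... | yes _ | _     = [] ∷ []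
    ... | no _  | yes _ = Unique.filter⁺ _ (unique S v)
    ... | no _  | no _  = unique S v

    coloured⁺ : ∀ {v} → v ∈ˢ Y⁺ → ∃[ b ] avail⁺ v ≡ b ∷ []
    coloured⁺ {v} v∈ with ∈Y⁺⁻ v∈ | v ≟ x | loses? v
    ... | _        | yes _  | _              = a , refl
    ... | inj₁ v≡x | no v≢x | _              = contradiction v≡x v≢x
    ... | inj₂ v∈Y | no _   | yes (v∉Y , _)  = contradiction v∈Y v∉Y
    ... | inj₂ v∈Y | no _   | no _           = coloured S v∈Y

    degree-< : ∀ {v} → Adjacent v x → degree (Y S) v < degree Y⁺ v
    degree-< {v} vx = p⊂q⇒∣p∣<∣q∣
      ( (λ u∈ → let u∈N , u∈Y = x∈p∩q⁻ (N v) (Y S) u∈ in x∈p∩q⁺ (u∈N , Y⊆Y⁺ u∈Y))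
      , x , x∈p∩q⁺ (∈-subset⁺ (adjacent? v) vx , x∈Y⁺)
      , λ x∈ → x∉Y (proj₂ (x∈p∩q⁻ (N v) (Y S) x∈)))

    -- A discard costs at most one colour, while the new coloured neighbour raises the degree.
    light⁺ : ∀ {v} → v ∈ˢ R → v ∉ˢ Y⁺ → degree Y⁺ v < s → s < degree Y⁺ v + length (avail⁺ v)
    light⁺ {v} v∈R v∉Y⁺ d<s with v ≟ x | loses? v
    ... | yes refl | _       = contradiction x∈Y⁺ v∉Y⁺
    ... | no _     | no _    = ℕ.<-≤-trans
      (light S v∈R (v∉Y⁺ ∘ Y⊆Y⁺) (ℕ.≤-<-trans (degree-mono Y⊆Y⁺) d<s))
      (ℕ.+-monoˡ-≤ _ (degree-mono Y⊆Y⁺))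
    ... | no _     | yes (v∉Y , vx , _) = begin-strict
      s                                                             <⟨ light S v∈R v∉Y (ℕ.<-trans (degree-< vx) d<s) ⟩
      degree (Y S) v + length (avail S v)                           ≤⟨ ℕ.+-monoʳ-≤ _ (length-remove a (unique S v)) ⟩
      degree (Y S) v + suc (length (remove a (avail S v)))          ≡⟨ ℕ.+-suc _ _ ⟩
      suc (degree (Y S) v) + length (remove a (avail S v))          ≤⟨ ℕ.+-monoˡ-≤ _ (degree-< vx) ⟩
      degree Y⁺ v + length (remove a (avail S v))                   ∎
      where open ℕ.≤-Reasoning

    -- After a discard the degree is still below `s`, so `light⁺` leaves at least two colours;
    -- without a discard the list is unchanged.
    choice⁺ : ∀ {v} → v ∈ˢ R → v ∉ˢ Y⁺ → 2 ≤ length (avail⁺ v)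
    choice⁺ {v} v∈R v∉Y⁺ with v ≟ x | loses? v | light⁺ v∈R v∉Y⁺
    ... | yes refl | _                 | _  = contradiction x∈Y⁺ v∉Y⁺
    ... | no _     | no _              | _  = choice S v∈R (v∉Y⁺ ∘ Y⊆Y⁺)
    ... | no _     | yes (_ , _ , d<s) | lt = ℕ.+-cancelˡ-≤ (degree Y⁺ v) _ _ (begin
      degree Y⁺ v + 2                                 ≡⟨ ℕ.+-comm (degree Y⁺ v) 2 ⟩
      suc (suc (degree Y⁺ v))                         ≤⟨ s≤s d<s ⟩
      suc s                                           ≤⟨ lt d<s ⟩
      degree Y⁺ v + length (remove a (avail S v))     ∎)
      where open ℕ.≤-Reasoning

    -- The only colour of the new vertex `x` is `a`, which its light neighbours have just discarded;
    -- for older `u` both lists can only shrink.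
    avoids⁺ : ∀ {v u b} → v ∈ˢ R → v ∉ˢ Y⁺ → degree Y⁺ v < s →
              u ∈ˢ Y⁺ → Adjacent v u → b ∈ avail⁺ u → b ∉ avail⁺ v
    avoids⁺ {v} {u} v∈R v∉Y⁺ d<s u∈ vu b∈u b∈v with ∈Y⁺⁻ u∈
    ... | inj₂ u∈Y  = avoids S v∈R (v∉Y⁺ ∘ Y⊆Y⁺) (ℕ.≤-<-trans (degree-mono Y⊆Y⁺) d<s) u∈Y vu
                        (avail⁺⊆ b∈u) (avail⁺⊆ b∈v)
    ... | inj₁ refl rewrite avail⁺-x with b∈u
    ...   | here refl with v ≟ x | loses? v
    ...     | yes refl | _         = v∉Y⁺ x∈Y⁺
    ...     | no _     | yes _     = proj₂ (∈-filter⁻ (λ b → ¬? (b ℤ.≟ a)) {xs = avail S v} b∈v) refl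
    ...     | no _     | no ¬loses = ¬loses (v∉Y⁺ ∘ Y⊆Y⁺ , vu , d<s)

    state : State R
    state = record
      { Y        = Y⁺
      ; avail    = avail⁺
      ; Y⊆R      = λ v∈ → [ (λ { refl → x∈R }) , Y⊆R S ]′ (∈Y⁺⁻ v∈)
      ; unique   = unique⁺
      ; coloured = coloured⁺
      ; choice   = choice⁺
      ; light    = light⁺
      ; avoids   = avoids⁺
      }

    extends : S ≼ state
    extends = Y⊆Y⁺ , avail⁺⊆

    size : ∣ Y⁺ ∣ ≤ suc ∣ Y S ∣
    size = ℕ.≤-trans (∣p∪q∣≤∣p∣+∣q∣ ⁅ x ⁆ (Y S)) (ℕ.≤-reflexive (cong (_+ ∣ Y S ∣) (∣⁅x⁆∣≡1 x)))

  record Extension {R} (S : State R) (ws : List Vertex) (a : ℤ) : Set where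
    field
      state   : State R
      extends : S ≼ state
      size    : ∣ Y state ∣ ≤ ∣ Y S ∣ + length ws
      added   : ∀ {v} → v ∈ ws → v ∈ˢ Y state
      avoided : ∀ {v} → v ∈ˢ Y state → v ∉ˢ Y S → a ∉ avail state v

  -- By `choice`, two colours are available at each uncoloured vertex when its turn comes, so one of
  -- them differs from `a`.
  extend : ∀ {R} (S : State R) ws a → (∀ {v} → v ∈ ws → v ∈ˢ R) → Extension S ws a
  extend S [] a _ = record
    { state   = S
    ; extends = ≼-refl {S = S}
    ; size    = ℕ.≤-reflexive (sym (ℕ.+-identityʳ _))
    ; added   = λ ()
    ; avoided = λ v∈ v∉ → contradiction v∈ v∉
    }
  extend S (w ∷ ws) a ws⊆R with extend S ws a (ws⊆R ∘ there)
  ... | E with w ∈? Y (Extension.state E)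
  ...   | yes w∈ = record
    { Extension E
    ; size  = ℕ.≤-trans (Extension.size E) (ℕ.+-monoʳ-≤ _ (ℕ.n≤1+n _))
    ; added = λ { (here refl) → w∈ ; (there v∈) → Extension.added E v∈ }
    }
  ...   | no w∉
    with choose-other a (unique (Extension.state E) w) (choice (Extension.state E) (ws⊆R (here refl)) w∉)
  ...     | b , b∈w , b≢a = record
    { state   = A.state
    ; extends = ≼-trans {S = S} {Extension.state E} {A.state} (Extension.extends E) A.extends
    ; size    = ℕ.≤-trans A.size (ℕ.≤-trans (s≤s (Extension.size E)) (ℕ.≤-reflexive (sym (ℕ.+-suc _ _))))
    ; added   = λ { (here refl) → A.x∈Y⁺ ; (there v∈) → A.Y⊆Y⁺ (Extension.added E v∈) }
    ; avoided = avoided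
    }
    where
    module A = Add (Extension.state E) (ws⊆R (here refl)) w∉ b∈w
    avoided : ∀ {v} → v ∈ˢ A.Y⁺ → v ∉ˢ Y S → a ∉ A.avail⁺ v
    avoided v∈ v∉Y a∈ with A.∈Y⁺⁻ v∈
    ... | inj₂ v∈Y = Extension.avoided E v∈Y v∉Y (A.avail⁺⊆ a∈)
    ... | inj₁ refl rewrite A.avail⁺-x with a∈
    ...   | here a≡b = b≢a (sym a≡b)

  -- A union of monochromatic components of G[R].
  Closed : Subset order → (Vertex → ℤ) → Subset order → Set
  Closed R c Z = Z ⊆ˢ R × (∀ {u v} → u ∈ˢ Z → v ∈ˢ R → Adjacent u v → c u ≡ c v → v ∈ˢ Z)

  Respects : ∀ {R} → State R → (Vertex → ℤ) → Set
  Respects {R} S c = ∀ {v} → v ∈ˢ R → c v ∈ avail S v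

  respects-≼ : ∀ {R} {S S′ : State R} {c} → S ≼ S′ → Respects S′ c → Respects S c
  respects-≼ (_ , avail⊆) resp v∈R = avail⊆ (resp v∈R)

  closed-∪ : ∀ {R c Z Z′} → Closed R c Z → Closed R c Z′ → Closed R c (Z ∪ Z′)
  closed-∪ {Z = Z} {Z′} (Z⊆ , cl) (Z′⊆ , cl′) =
    (λ v∈ → [ Z⊆ , Z′⊆ ]′ (x∈p∪q⁻ Z Z′ v∈)) , λ u∈ v∈R uv eq → x∈p∪q⁺
      ([ (λ u∈Z → inj₁ (cl u∈Z v∈R uv eq)) , (λ u∈Z′ → inj₂ (cl′ u∈Z′ v∈R uv eq)) ]′ (x∈p∪q⁻ Z Z′ u∈))

  -- Sealing monochromatic components

  module Sealing {t : ℕ} (K⋢G : ¬ (K s t ⊑ G)) where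
    open Growth t

    -- As `closed` covers every colouring that respects the state, sealing is final: however the
    -- remaining vertices are coloured, no monochromatic edge of `R` leaves `Z`.
    record Sealed {R} (S : State R) (bound : ℕ) (ys : List Vertex) : Set where
      field
        state   : State R
        extends : S ≼ state
        size    : ∣ Y state ∣ ≤ bound
        Z       : Subset order
        Z⊆Y     : Z ⊆ˢ Y state
        ys⊆Z    : ∀ {y} → y ∈ ys → y ∈ˢ Z
        closed  : ∀ {c} → Respects state c → Closed R c Z

    -- Colour every vertex with at least s neighbours in Y, avoiding a; all other
    -- uncoloured neighbours of Y already avoid the colours of their neighbours.
    seal-colour : ∀ {R} (S : State R) {y} → y ∈ˢ Y S → Sealed S (growth ∣ Y S ∣) (y ∷ [])
    seal-colour {R} S {y} y∈Y = record
      { state   = E.state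
      ; extends = E.extends
      ; size    = ℕ.≤-trans E.size (ℕ.+-monoʳ-≤ _ few)
      ; Z       = Z
      ; Z⊆Y     = proj₁ E.extends ∘ proj₁ ∘ ∈-subset⁻ Z?
      ; ys⊆Z    = λ { (here refl) → ∈-subset⁺ Z? (y∈Y , subst (a ∈_) (sym y-colour) (here refl)) }
      ; closed  = λ resp → Y⊆R S ∘ proj₁ ∘ ∈-subset⁻ Z? , closed resp
      }
      where
      a = proj₁ (coloured S y∈Y)
      y-colour = proj₂ (coloured S y∈Y)

      Heavy? : ∀ v → Dec (v ∈ˢ R × v ∉ˢ Y S × s ≤ degree (Y S) v)
      Heavy? v = (v ∈? R) ×-dec ¬? (v ∈? Y S) ×-dec (s ≤? degree (Y S) v)

      heavy : List Vertex
      heavy = filter Heavy? (allFin order)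

      heavy⁻ : ∀ {v} → v ∈ heavy → v ∈ˢ R × v ∉ˢ Y S × s ≤ degree (Y S) v
      heavy⁻ v∈ = proj₂ (∈-filter⁻ Heavy? {xs = allFin order} v∈)

      few : length heavy ≤ t * 2 ^ ∣ Y S ∣
      few = few-common-neighbours K⋢G (Y S) (Unique.filter⁺ Heavy? (Unique.allFin⁺ order)) (proj₂ ∘ heavy⁻)

      module E = Extension (extend S heavy a (proj₁ ∘ heavy⁻))

      -- The whole colour class of `a` in `Y S` is enclosed, since vertices of the component of `y`
      -- may be among them.
      Z? : ∀ v → Dec (v ∈ˢ Y S × a ∈ avail S v)
      Z? v = (v ∈? Y S) ×-dec (a ∈ˡ? avail S v)

      Z : Subset order
      Z = subset Z?

      closed : ∀ {c} → Respects E.state c →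
               ∀ {u v} → u ∈ˢ Z → v ∈ˢ R → Adjacent u v → c u ≡ c v → v ∈ˢ Z
      closed {c} resp {u} {v} u∈Z v∈R uv cu≡cv with ∈-subset⁻ Z? u∈Z
      ... | u∈Y , a∈u = v∈Z
        where
        a≡cu : a ≡ c u
        a≡cu = one-colour S u∈Y a∈u (proj₂ E.extends (resp (Y⊆R S u∈Y)))
        a∈v : a ∈ avail E.state v
        a∈v = subst (_∈ avail E.state v) (sym (trans a≡cu cu≡cv)) (resp v∈R)
        v∈Z : v ∈ˢ Z
        v∈Z with v ∈? Y S | s ≤? degree (Y S) v
        ... | yes v∈Y | _      = ∈-subset⁺ Z? (v∈Y , proj₂ E.extends a∈v)
        ... | no  v∉Y | yes s≤ = contradiction a∈v
          (E.avoided (E.added (∈-filter⁺ Heavy? (∈-allFin v) (v∈R , v∉Y , s≤))) v∉Y)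
        ... | no  v∉Y | no  s≰ = contradiction (proj₂ E.extends a∈v)
          (avoids S v∈R v∉Y (ℕ.≰⇒> s≰) u∈Y (adjacent-sym uv) a∈u)

    -- There is one round per listed vertex rather than per colour; repeated colours are harmless.
    -- Each round starts from the enlarged `Y`, whence the iterated bound, and sets sealed earlier
    -- stay closed because states only get extended.
    seal : ∀ {R} (S : State R) ys → (∀ {y} → y ∈ ys → y ∈ˢ Y S) →
           Sealed S (growths (length ys) ∣ Y S ∣) ys
    seal S [] _ = record
      { state   = S
      ; extends = ≼-refl {S = S}
      ; size    = ℕ.≤-refl
      ; Z       = ⊥ˢ
      ; Z⊆Y     = λ v∈ → contradiction v∈ ∉⊥
      ; ys⊆Z    = λ ()
      ; closed  = λ _ → (λ v∈ → contradiction v∈ ∉⊥)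
                      , λ v∈ → contradiction v∈ ∉⊥
      }
    seal S (y ∷ ys) ys⊆Y = record
      { state   = Q.state
      ; extends = ≼-trans {S = S} {P.state} {Q.state} P.extends Q.extends
      ; size    = ℕ.≤-trans Q.size (growths-mono {length ys} ℕ.≤-refl P.size)
      ; Z       = P.Z ∪ Q.Z
      ; Z⊆Y     = λ v∈ → [ proj₁ Q.extends ∘ P.Z⊆Y , Q.Z⊆Y ]′ (x∈p∪q⁻ P.Z Q.Z v∈)
      ; ys⊆Z    = λ { (here refl) → x∈p∪q⁺ (inj₁ (P.ys⊆Z (here refl)))
                    ; (there y∈)  → x∈p∪q⁺ (inj₂ (Q.ys⊆Z y∈)) }
      ; closed  = λ resp → closed-∪ (P.closed (respects-≼ {S = P.state} {Q.state} Q.extends resp)) (Q.closed resp)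
      }
      where
      module P = Sealed (seal-colour S (ys⊆Y (here refl)))
      module Q = Sealed (seal P.state ys (proj₁ P.extends ∘ ys⊆Y ∘ there))

-- Gluing along a separation

mirror : ∀ {G} → Separation G → Separation G
mirror P = record
  { left = right ; right = left ; covers = swap ∘ covers ; left-end = right-end ; right-end = left-end }
  where open Separation P

module Gluing (G : Graph) (s : ℕ) where
  open Graph G hiding (size)
  open Neighbourhoods G
  open Colourings G s
  open Separation
  open State

  -- Separators are coloured before splitting, so only components meeting `Y` can merge under
  -- gluing; hence the separate bound on `Z`. Closed sets stand in for components: `C` merely
  -- encloses the component of `v`.
  record Solution {R} (S : State R) (bound η : ℕ) : Set where
    field
      colour   : Vertex → ℤ
      respects : Respects S colour
      Z        : Subset order
      closed   : Closed R colour Z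
      Y⊆Z      : Y S ⊆ˢ Z
      Z-size   : ∣ Z ∣ ≤ bound
      cluster  : ∀ {v} → v ∈ˢ R → ∃[ C ] (v ∈ˢ C × Closed R colour C × ∣ C ∣ ≤ η)

  closed-cong : ∀ {R c c′ Z} → (∀ {v} → v ∈ˢ R → c v ≡ c′ v) → Closed R c Z → Closed R c′ Z
  closed-cong eq (Z⊆R , cl) = Z⊆R , λ u∈Z v∈R uv c′u≡c′v →
    cl u∈Z v∈R uv (trans (eq (Z⊆R u∈Z)) (trans c′u≡c′v (sym (eq v∈R))))

  module Halves {R : Subset order} (P : Separation G) (c : Vertex → ℤ) where

    exit : ∀ {Z u v} → Z ⊆ˢ R ∩ left P → u ∈ˢ Z → v ∉ˢ left P → Adjacent u v →
           u ∈ˢ R × u ∈ˢ left P × u ∈ˢ right P × v ∈ˢ right P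
    exit {u = u} {v} Z⊆ u∈Z v∉L uv with x∈p∩q⁻ R (left P) (Z⊆ u∈Z) | covers P v
    ... | u∈R , u∈L | inj₁ v∈L  = contradiction v∈L v∉L
    ... | u∈R , u∈L | inj₂ v∈Rt = u∈R , u∈L , right-end P (adjacent-sym uv) v∈Rt v∉L , v∈Rt

    -- An edge that leaves the left side starts in the overlap, hence in `W`, which then absorbs its
    -- other end.
    closed-step : ∀ {Z W} → Closed (R ∩ left P) c Z → Closed (R ∩ right P) c W →
                  (∀ {v} → v ∈ˢ R → v ∈ˢ left P → v ∈ˢ right P → v ∈ˢ W) →
                  ∀ {u v} → u ∈ˢ Z → v ∈ˢ R → Adjacent u v → c u ≡ c v → v ∈ˢ Z ⊎ v ∈ˢ W
    closed-step (Z⊆ , clZ) (_ , clW) mid⊆W {v = v} u∈Z v∈R uv eq with v ∈? left P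
    ... | yes v∈L = inj₁ (clZ u∈Z (x∈p∩q⁺ (v∈R , v∈L)) uv eq)
    ... | no  v∉L = let u∈R , u∈L , u∈Rt , v∈Rt = exit Z⊆ u∈Z v∉L uv in
      inj₂ (clW (mid⊆W u∈R u∈L u∈Rt) (x∈p∩q⁺ (v∈R , v∈Rt)) uv eq)

    -- `W` contains the overlap, so no edge leaves the left side from `Z ∩ ∁ W`; and a monochromatic
    -- edge into `W` would, read backwards, leave `W`.
    closed-remainder : ∀ {Z W} → Closed (R ∩ left P) c Z → Closed (R ∩ left P) c W →
                       (∀ {v} → v ∈ˢ R → v ∈ˢ left P → v ∈ˢ right P → v ∈ˢ W) →
                       Closed R c (Z ∩ ∁ W)
    closed-remainder {Z} {W} (Z⊆ , clZ) (_ , clW) mid⊆W =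
      (λ u∈ → proj₁ (x∈p∩q⁻ R (left P) (Z⊆ (proj₁ (x∈p∩q⁻ Z (∁ W) u∈))))) , step
      where
      step : ∀ {u v} → u ∈ˢ Z ∩ ∁ W → v ∈ˢ R → Adjacent u v → c u ≡ c v → v ∈ˢ Z ∩ ∁ W
      step {u} {v} u∈ v∈R uv eq with x∈p∩q⁻ Z (∁ W) u∈ | v ∈? left P
      ... | u∈Z , u∈∁W | yes v∈L = x∈p∩q⁺
        ( clZ u∈Z (x∈p∩q⁺ (v∈R , v∈L)) uv eq
        , x∉p⇒x∈∁p (λ v∈W → x∈∁p⇒x∉p u∈∁W (clW v∈W (Z⊆ u∈Z) (adjacent-sym uv) (sym eq))))
      ... | u∈Z , u∈∁W | no v∉L = let u∈R , u∈L , u∈Rt , _ = exit Z⊆ u∈Z v∉L uv in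
        contradiction (mid⊆W u∈R u∈L u∈Rt) (x∈∁p⇒x∉p u∈∁W)

  Middle⊆ : ∀ {R} → Separation G → Subset order → Set
  Middle⊆ {R} P Z = ∀ {v} → v ∈ˢ R → v ∈ˢ left P → v ∈ˢ right P → v ∈ˢ Z

  -- An uncoloured vertex of the left side lies outside the coloured overlap, so all its neighbours
  -- are on the left and its degree into `Y S` is unchanged.
  restrict : ∀ {R} (S : State R) (P : Separation G) → Middle⊆ {R} P (Y S) → State (R ∩ left P)
  restrict {R} S P mid⊆Y = record
    { Y        = Y S ∩ left P
    ; avail    = avail S
    ; Y⊆R      = λ v∈ → let v∈Y , v∈L = x∈p∩q⁻ (Y S) (left P) v∈ in x∈p∩q⁺ (Y⊆R S v∈Y , v∈L)
    ; unique   = unique S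
    ; coloured = coloured S ∘ proj₁ ∘ x∈p∩q⁻ (Y S) (left P)
    ; choice   = λ v∈ v∉ → choice S (in-R v∈) (not-Y v∈ v∉)
    ; light    = λ v∈ v∉ d<s → subst (λ d → s < d + _) (sym (same-degree v∈ v∉))
                   (light S (in-R v∈) (not-Y v∈ v∉) (subst (_< s) (same-degree v∈ v∉) d<s))
    ; avoids   = λ v∈ v∉ d<s u∈ → avoids S (in-R v∈) (not-Y v∈ v∉)
                   (subst (_< s) (same-degree v∈ v∉) d<s) (proj₁ (x∈p∩q⁻ (Y S) (left P) u∈))
    }
    where
    in-R : ∀ {v} → v ∈ˢ R ∩ left P → v ∈ˢ R
    in-R = proj₁ ∘ x∈p∩q⁻ R (left P)
    in-L : ∀ {v} → v ∈ˢ R ∩ left P → v ∈ˢ left P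
    in-L = proj₂ ∘ x∈p∩q⁻ R (left P)
    not-Y : ∀ {v} → v ∈ˢ R ∩ left P → v ∉ˢ Y S ∩ left P → v ∉ˢ Y S
    not-Y v∈ v∉ v∈Y = v∉ (x∈p∩q⁺ (v∈Y , in-L v∈))
    same-degree : ∀ {v} → v ∈ˢ R ∩ left P → v ∉ˢ Y S ∩ left P →
                  degree (Y S ∩ left P) v ≡ degree (Y S) v
    same-degree {v} v∈ v∉ = ℕ.≤-antisym
      (degree-mono {v = v} (proj₁ ∘ x∈p∩q⁻ (Y S) (left P)))
      (p⊆q⇒∣p∣≤∣q∣ λ u∈ → let u∈N , u∈Y = x∈p∩q⁻ (N v) (Y S) u∈ in
        x∈p∩q⁺ (u∈N , x∈p∩q⁺ (u∈Y ,
          left-end P (∈-subset⁻ (adjacent? v) u∈N) (in-L v∈)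
            (λ v∈Rt → not-Y v∈ v∉ (mid⊆Y (in-R v∈) (in-L v∈) v∈Rt)))))

  -- The two colourings agree on the overlap, where every vertex is coloured and thus has a single
  -- available colour.
  glue : ∀ {R} {S : State R} (P : Separation G) (mid⊆Y : Middle⊆ {R} P (Y S)) {b₁ b₂ η} → b₁ + b₂ ≤ η →
         Solution (restrict S P mid⊆Y) b₁ η →
         Solution (restrict S (mirror P) (λ v∈R v∈Rt v∈L → mid⊆Y v∈R v∈L v∈Rt)) b₂ η →
         Solution S (b₁ + b₂) η
  glue {R} {S} P mid⊆Y {η = η} b₁+b₂≤η sol₁ sol₂ = record
    { colour   = c
    ; respects = c-respects
    ; Z        = A.Z ∪ B.Z
    ; closed   = union-closed
    ; Y⊆Z      = Y⊆Z
    ; Z-size   = Z-size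
    ; cluster  = cluster
    }
    where
    module A = Solution sol₁
    module B = Solution sol₂

    c : Vertex → ℤ
    c v with v ∈? left P
    ... | yes _ = A.colour v
    ... | no  _ = B.colour v

    c-left : ∀ {v} → v ∈ˢ R ∩ left P → A.colour v ≡ c v
    c-left {v} v∈ with v ∈? left P
    ... | yes _   = refl
    ... | no  v∉L = contradiction (proj₂ (x∈p∩q⁻ R (left P) v∈)) v∉L

    c-right : ∀ {v} → v ∈ˢ R ∩ right P → B.colour v ≡ c v
    c-right {v} v∈ with v ∈? left P
    ... | no  _   = refl
    ... | yes v∈L = let v∈R , v∈Rt = x∈p∩q⁻ R (right P) v∈ in
      one-colour S (mid⊆Y v∈R v∈L v∈Rt) (B.respects v∈) (A.respects (x∈p∩q⁺ (v∈R , v∈L)))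

    c-respects : Respects S c
    c-respects {v} v∈R with covers P v
    ... | inj₁ v∈L  = let v∈ = x∈p∩q⁺ (v∈R , v∈L) in subst (_∈ avail S v) (c-left v∈) (A.respects v∈)
    ... | inj₂ v∈Rt = let v∈ = x∈p∩q⁺ (v∈R , v∈Rt) in subst (_∈ avail S v) (c-right v∈) (B.respects v∈)

    mid⊆A : Middle⊆ {R} P A.Z
    mid⊆A v∈R v∈L v∈Rt = A.Y⊆Z (x∈p∩q⁺ (mid⊆Y v∈R v∈L v∈Rt , v∈L))
    mid⊆B : Middle⊆ {R} P B.Z
    mid⊆B v∈R v∈L v∈Rt = B.Y⊆Z (x∈p∩q⁺ (mid⊆Y v∈R v∈L v∈Rt , v∈Rt))

    closedA = closed-cong c-left A.closed
    closedB = closed-cong c-right B.closed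

    union-closed : Closed R c (A.Z ∪ B.Z)
    union-closed =
      (λ v∈ → [ proj₁ ∘ x∈p∩q⁻ R _ ∘ proj₁ A.closed , proj₁ ∘ x∈p∩q⁻ R _ ∘ proj₁ B.closed ]′
                (x∈p∪q⁻ A.Z B.Z v∈)) ,
      λ u∈ v∈R uv eq → x∈p∪q⁺
        ([ (λ u∈A → Halves.closed-step P c closedA closedB mid⊆B u∈A v∈R uv eq)
         , (λ u∈B → swap (Halves.closed-step (mirror P) c closedB closedA
                           (λ v∈R v∈Rt v∈L → mid⊆A v∈R v∈L v∈Rt) u∈B v∈R uv eq))
         ]′ (x∈p∪q⁻ A.Z B.Z u∈))

    Y⊆Z : Y S ⊆ˢ A.Z ∪ B.Z
    Y⊆Z {v} v∈Y with covers P v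
    ... | inj₁ v∈L  = x∈p∪q⁺ (inj₁ (A.Y⊆Z (x∈p∩q⁺ (v∈Y , v∈L))))
    ... | inj₂ v∈Rt = x∈p∪q⁺ (inj₂ (B.Y⊆Z (x∈p∩q⁺ (v∈Y , v∈Rt))))

    Z-size = ℕ.≤-trans (∣p∪q∣≤∣p∣+∣q∣ A.Z B.Z) (ℕ.+-mono-≤ A.Z-size B.Z-size)

    cluster : ∀ {v} → v ∈ˢ R → ∃[ C ] (v ∈ˢ C × Closed R c C × ∣ C ∣ ≤ η)
    cluster {v} v∈R with v ∈? A.Z | v ∈? B.Z | covers P v
    -- Components meeting `A.Z` or `B.Z` may have merged, so the whole union encloses them, and
    -- `b₁ + b₂ ≤ η` bounds it.
    ... | yes v∈A | _       | _ = A.Z ∪ B.Z , x∈p∪q⁺ (inj₁ v∈A) , union-closed , ℕ.≤-trans Z-size b₁+b₂≤η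
    ... | no _    | yes v∈B | _ = A.Z ∪ B.Z , x∈p∪q⁺ (inj₂ v∈B) , union-closed , ℕ.≤-trans Z-size b₁+b₂≤η
    -- Removing `A.Z`, which contains the overlap, makes the enclosing set closed in all of `R`.
    ... | no v∉A  | no _    | inj₁ v∈L =
      let C , v∈C , C-closed , C-size = A.cluster (x∈p∩q⁺ (v∈R , v∈L)) in
      C ∩ ∁ A.Z , x∈p∩q⁺ (v∈C , x∉p⇒x∈∁p v∉A)
      , Halves.closed-remainder P c (closed-cong c-left C-closed) closedA mid⊆A
      , ℕ.≤-trans (∣p∩q∣≤∣p∣ C _) C-size
    ... | no _    | no v∉B  | inj₂ v∈Rt =
      let C , v∈C , C-closed , C-size = B.cluster (x∈p∩q⁺ (v∈R , v∈Rt)) in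
      C ∩ ∁ B.Z , x∈p∩q⁺ (v∈C , x∉p⇒x∈∁p v∉B)
      , Halves.closed-remainder (mirror P) c (closed-cong c-right C-closed) closedB
          (λ v∈R v∈Rt v∈L → mid⊆B v∈R v∈L v∈Rt)
      , ℕ.≤-trans (∣p∩q∣≤∣p∣ C _) C-size

-- Numerical bounds

module Bounds (t w : ℕ) where
  open Growth t

  -- A separator of w + 1 vertices is counted on both of its sides, hence p; a
  -- set Y of more than few = 3p vertices can be split, and sealing a smaller one,
  -- enlarged by one vertex, yields at most many coloured vertices.
  p few many η : ℕ
  p    = suc w + suc w
  few  = p + (p + p)
  many = growths few (suc few)

  -- The maximum with 1 guarantees at least `many`, the size a sealing may reach; beyond `p` the
  -- value is linear in the excess, as splitting requires.
  bound : ℕ → ℕ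
  bound n = many * (1 ⊔ (n ∸ p))

  -- Every call of `solve` has at most `many` coloured vertices, so this dominates the bounds that
  -- occur.
  η = bound many

  few<many : few < many
  few<many = growths-mono {zero} {few} z≤n ℕ.≤-refl

  many≤bound : ∀ n → many ≤ bound n
  many≤bound n = ℕ.≤-trans (ℕ.≤-reflexive (sym (ℕ.*-identityʳ many)))
                           (ℕ.*-monoʳ-≤ many (ℕ.m≤m⊔n 1 (n ∸ p)))

  bound≤η : ∀ {n} → n ≤ many → bound n ≤ η
  bound≤η n≤ = ℕ.*-monoʳ-≤ many (ℕ.⊔-monoʳ-≤ 1 (ℕ.∸-monoˡ-≤ p n≤))

  η-nonZero : NonZero η
  η-nonZero = >-nonZero (ℕ.<-≤-trans (ℕ.≤-<-trans z≤n few<many) (many≤bound many))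

  -- Splitting pays for itself: the separator is charged to the p
  -- vertices deducted on each side.
  bound-split : ∀ {a b n} → p < a → p < b → a + b ≤ n + p →
                a < n × b < n × bound a + bound b ≤ bound n
  bound-split {a} {b} {n} p<a p<b a+b≤ with ℕ.m≤n⇒∃[o]m+o≡n p<a | ℕ.m≤n⇒∃[o]m+o≡n p<b
  ... | x , refl | y , refl = a<n , b<n , bounds
    where
    open ℕ.≤-Reasoning
    -- As `p < a`, the deduction leaves `suc x`, and `1 ⊔ suc x` computes to `suc x`.
    excess : ∀ x → suc p + x ∸ p ≡ suc x
    excess x = trans (cong (_∸ p) (sym (ℕ.+-suc p x))) (ℕ.m+n∸m≡n p (suc x))
    regroup : ∀ p x y → (suc p + x) + (suc p + y) ≡ (p + (suc x + suc y)) + p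
    regroup = solve-∀
    regroup₁ : ∀ p x y → suc (suc p + x) + y ≡ p + (suc x + suc y)
    regroup₁ = solve-∀
    regroup₂ : ∀ p x y → suc (suc p + y) + x ≡ p + (suc x + suc y)
    regroup₂ = solve-∀
    sum≤n : p + (suc x + suc y) ≤ n
    sum≤n = ℕ.+-cancelʳ-≤ p _ _ (subst (_≤ n + p) (regroup p x y) a+b≤)
    a<n : suc p + x < n
    a<n = ℕ.≤-trans (ℕ.m≤m+n _ y) (subst (_≤ n) (sym (regroup₁ p x y)) sum≤n)
    b<n : suc p + y < n
    b<n = ℕ.≤-trans (ℕ.m≤m+n _ x) (subst (_≤ n) (sym (regroup₂ p x y)) sum≤n)
    bounds : bound (suc p + x) + bound (suc p + y) ≤ bound n
    bounds = begin
      bound (suc p + x) + bound (suc p + y)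
        ≡⟨ cong₂ (λ i j → many * (1 ⊔ i) + many * (1 ⊔ j)) (excess x) (excess y) ⟩
      many * suc x + many * suc y
        ≡⟨ ℕ.*-distribˡ-+ many (suc x) (suc y) ⟨
      many * (suc x + suc y)
        ≡⟨ cong (many *_) (ℕ.m+n∸m≡n p _) ⟨
      many * (p + (suc x + suc y) ∸ p)
        ≤⟨ ℕ.*-monoʳ-≤ many (ℕ.∸-monoˡ-≤ p sum≤n) ⟩
      many * (n ∸ p)
        ≤⟨ ℕ.*-monoʳ-≤ many (ℕ.m≤n⊔m 1 (n ∸ p)) ⟩
      bound n ∎

-- The recursion on partial colourings

module Completion {G : Graph} {s t w : ℕ} (K⋢G : ¬ (K s t ⊑ G))
                  (D : TreeDecomposition G) (width≤w : TreeDecomposition.width D ≤ w) where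
  open Graph G hiding (size)
  open Bounds t w
  open Growth t
  open Separators D width≤w
  open Separation
  open Colourings G s
  open Sealing K⋢G
  open Gluing G s
  open State

  weaken : ∀ {R} {S S′ : State R} {b b′} → S ≼ S′ → b ≤ b′ → Solution S′ b η → Solution S b′ η
  weaken {S = S} {S′} S≼S′ b≤b′ sol = record
    { Solution sol
    ; respects = respects-≼ {S = S} {S′} S≼S′ (Solution.respects sol)
    ; Y⊆Z      = Solution.Y⊆Z sol ∘ proj₁ S≼S′
    ; Z-size   = ℕ.≤-trans (Solution.Z-size sol) b≤b′
    }

  Open? : ∀ {R} (S : State R) v → Dec (v ∈ˢ R × v ∉ˢ Y S)
  Open? {R} S v = (v ∈? R) ×-dec ¬? (v ∈? Y S)

  solve-full : ∀ {R} (S : State R) → (∀ {v} → v ∈ˢ R → v ∈ˢ Y S) → ∣ Y S ∣ ≤ many →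
               Solution S (bound ∣ Y S ∣) η
  solve-full {R} S R⊆Y Y≤ = record
    { colour   = c
    ; respects = c-respects
    ; Z        = Y S
    ; closed   = Y-closed
    ; Y⊆Z      = λ v∈ → v∈
    ; Z-size   = ℕ.≤-trans Y≤ (many≤bound ∣ Y S ∣)
    ; cluster  = λ v∈R → Y S , R⊆Y v∈R , Y-closed , ℕ.≤-trans Y≤ (many≤bound many)
    }
    where
    c : Vertex → ℤ
    c v with v ∈? Y S
    ... | yes v∈Y = proj₁ (coloured S v∈Y)
    -- A default that is never taken on `R`, since `R` lies in `Y S`.
    ... | no  _   = 0ℤ
    c-respects : Respects S c
    c-respects {v} v∈R with v ∈? Y S
    ... | yes v∈Y = subst (_ ∈_) (sym (proj₂ (coloured S v∈Y))) (here refl)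
    ... | no  v∉Y = contradiction (R⊆Y v∈R) v∉Y
    Y-closed : Closed R c (Y S)
    Y-closed = Y⊆R S , λ _ v∈R _ _ → R⊆Y v∈R

  -- Lexicographic induction on the bounds r for the uncoloured and m for the
  -- coloured vertices.
  solve : ∀ r m {R} (S : State R) → ∣ R ∩ ∁ (Y S) ∣ ≤ r → ∣ Y S ∣ ≤ m → ∣ Y S ∣ ≤ many →
          Solution S (bound ∣ Y S ∣) η

  -- Colouring the separator first makes both restrictions states. By `bound-split` each side has
  -- fewer coloured vertices than `Y S`, so `m` drops, while no new uncoloured vertex appears.
  solve-split : ∀ r m {R} (S : State R) → ∣ R ∩ ∁ (Y S) ∣ ≤ r → ∣ Y S ∣ ≤ suc m → ∣ Y S ∣ ≤ many →
                few < ∣ Y S ∣ → Solution S (bound ∣ Y S ∣) η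
  solve-split r m {R} S open≤r Y≤m Y≤many few<Y
    with separation {p} (ℕ.m≤m+n (suc w) (suc w)) (Y S) few<Y
  ... | P , P-order , p<L , p<Rt = weaken {S = S} {E.state} E.extends bounds
    (glue {S = E.state} P mid⊆Y (ℕ.≤-trans bounds (bound≤η Y≤many))
      (solve r m (restrict E.state P mid⊆Y) (shrink P)
        (ℕ.≤-pred (ℕ.≤-trans a<n Y≤m)) (ℕ.≤-trans (ℕ.<⇒≤ a<n) Y≤many))
      (solve r m (restrict E.state (mirror P) mid⊆Y′) (shrink (mirror P))
        (ℕ.≤-pred (ℕ.≤-trans b<n Y≤m)) (ℕ.≤-trans (ℕ.<⇒≤ b<n) Y≤many)))
    where
    middle : Subset order
    middle = R ∩ (left P ∩ right P)
    -- The colour `0ℤ` to be avoided is an arbitrary choice.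
    module E = Extension (extend S (elements middle) 0ℤ (proj₁ ∘ x∈p∩q⁻ R _ ∘ ∈-elements⁻))
    Y′ = Y E.state

    mid⊆Y : Middle⊆ {R} P Y′
    mid⊆Y v∈R v∈L v∈Rt = E.added (∈-elements⁺ (x∈p∩q⁺ (v∈R , x∈p∩q⁺ (v∈L , v∈Rt))))
    mid⊆Y′ : Middle⊆ {R} (mirror P) Y′
    mid⊆Y′ v∈R v∈Rt v∈L = mid⊆Y v∈R v∈L v∈Rt

    shrink : ∀ Q → ∣ (R ∩ left Q) ∩ ∁ (Y′ ∩ left Q) ∣ ≤ r
    shrink Q = ℕ.≤-trans (p⊆q⇒∣p∣≤∣q∣ sub) open≤r
      where
      sub : (R ∩ left Q) ∩ ∁ (Y′ ∩ left Q) ⊆ˢ R ∩ ∁ (Y S)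
      sub v∈ = let v∈RL , v∈∁ = x∈p∩q⁻ (R ∩ left Q) _ v∈
                   v∈R , v∈L = x∈p∩q⁻ R (left Q) v∈RL in
        x∈p∩q⁺ (v∈R , x∉p⇒x∈∁p (λ v∈Y → x∈∁p⇒x∉p v∈∁ (x∈p∩q⁺ (proj₁ E.extends v∈Y , v∈L))))

    grow-p : ∀ A → p < ∣ Y S ∩ A ∣ → p < ∣ Y′ ∩ A ∣
    grow-p A p< = ℕ.<-≤-trans p< (p⊆q⇒∣p∣≤∣q∣ λ v∈ →
      let v∈Y , v∈A = x∈p∩q⁻ (Y S) A v∈ in x∈p∩q⁺ (proj₁ E.extends v∈Y , v∈A))

    Y′-size : ∣ Y′ ∣ ≤ ∣ Y S ∣ + suc w
    Y′-size = ℕ.≤-trans E.size (ℕ.+-monoʳ-≤ ∣ Y S ∣ (begin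
      length (elements middle)   ≡⟨ length-elements middle ⟩
      ∣ middle ∣                 ≤⟨ ∣p∩q∣≤∣q∣ R _ ⟩
      ∣ left P ∩ right P ∣       ≤⟨ P-order ⟩
      suc w                      ∎))
      where open ℕ.≤-Reasoning

    -- The separator is charged twice, once for its newly coloured vertices and once for being
    -- counted on both sides; `p` is the sum.
    total : ∣ Y′ ∩ left P ∣ + ∣ Y′ ∩ right P ∣ ≤ ∣ Y S ∣ + p
    total = begin
      ∣ Y′ ∩ left P ∣ + ∣ Y′ ∩ right P ∣
        ≡⟨ ∣p∪q∣+∣p∩q∣≡∣p∣+∣q∣ (Y′ ∩ left P) (Y′ ∩ right P) ⟨
      ∣ Y′ ∩ left P ∪ Y′ ∩ right P ∣ + ∣ (Y′ ∩ left P) ∩ (Y′ ∩ right P) ∣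
        ≤⟨ ℕ.+-mono-≤ (p⊆q⇒∣p∣≤∣q∣ union⊆) (ℕ.≤-trans (p⊆q⇒∣p∣≤∣q∣ inter⊆) P-order) ⟩
      ∣ Y′ ∣ + suc w
        ≤⟨ ℕ.+-monoˡ-≤ (suc w) Y′-size ⟩
      ∣ Y S ∣ + suc w + suc w
        ≡⟨ ℕ.+-assoc ∣ Y S ∣ (suc w) (suc w) ⟩
      ∣ Y S ∣ + p ∎
      where
      open ℕ.≤-Reasoning
      union⊆ : Y′ ∩ left P ∪ Y′ ∩ right P ⊆ˢ Y′
      union⊆ v∈ = [ proj₁ ∘ x∈p∩q⁻ Y′ _ , proj₁ ∘ x∈p∩q⁻ Y′ _ ]′ (x∈p∪q⁻ (Y′ ∩ left P) _ v∈)
      inter⊆ : (Y′ ∩ left P) ∩ (Y′ ∩ right P) ⊆ˢ left P ∩ right P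
      inter⊆ v∈ = let v∈L , v∈Rt = x∈p∩q⁻ (Y′ ∩ left P) _ v∈ in
        x∈p∩q⁺ (proj₂ (x∈p∩q⁻ Y′ _ v∈L) , proj₂ (x∈p∩q⁻ Y′ _ v∈Rt))

    accounting = bound-split (grow-p (left P) p<L) (grow-p (right P) p<Rt) total
    a<n    = proj₁ accounting
    b<n    = proj₁ (proj₂ accounting)
    bounds = proj₂ (proj₂ accounting)

  -- Colouring `v` before sealing makes `r` drop, and explains the `suc few` in `many`.
  solve-seal : ∀ r {R} (S : State R) {v} → v ∈ˢ R → v ∉ˢ Y S → ∣ R ∩ ∁ (Y S) ∣ ≤ suc r →
               ∣ Y S ∣ ≤ few → Solution S (bound ∣ Y S ∣) η
  solve-seal r {R} S {v} v∈R v∉Y open≤r Y≤few = record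
    { Solution sol
    ; respects = respects-≼ {S = S} {Q.state} S≼Q (Solution.respects sol)
    -- The `Z` of the recursive solution encloses the enlarged `Y` and may exceed the bound for the
    -- old one; the sealed set has at most `many` vertices.
    ; Z        = Q.Z
    ; closed   = Q.closed (Solution.respects sol)
    ; Y⊆Z      = Q.ys⊆Z ∘ ∈-elements⁺
    ; Z-size   = ℕ.≤-trans (ℕ.≤-trans (p⊆q⇒∣p∣≤∣q∣ Q.Z⊆Y) Q-size) (many≤bound ∣ Y S ∣)
    }
    where
    [v]⊆R : ∀ {u} → u ∈ v ∷ [] → u ∈ˢ R
    [v]⊆R (here refl) = v∈R
    module E = Extension (extend S (v ∷ []) 0ℤ [v]⊆R)
    module Q = Sealed (seal E.state (elements (Y S)) (proj₁ E.extends ∘ ∈-elements⁻))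
    S≼Q : S ≼ Q.state
    S≼Q = ≼-trans {S = S} {E.state} {Q.state} E.extends Q.extends
    Q-size : ∣ Y Q.state ∣ ≤ many
    Q-size = ℕ.≤-trans Q.size (growths-mono
      (ℕ.≤-trans (ℕ.≤-reflexive (length-elements (Y S))) Y≤few)
      (ℕ.≤-trans E.size (ℕ.≤-trans (ℕ.≤-reflexive (ℕ.+-comm ∣ Y S ∣ 1)) (s≤s Y≤few))))
    fewer : ∣ R ∩ ∁ (Y Q.state) ∣ < ∣ R ∩ ∁ (Y S) ∣
    fewer = p⊂q⇒∣p∣<∣q∣
      ( (λ u∈ → let u∈R , u∈∁ = x∈p∩q⁻ R _ u∈ in
           x∈p∩q⁺ (u∈R , x∉p⇒x∈∁p (x∈∁p⇒x∉p u∈∁ ∘ proj₁ S≼Q)))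
      , v , x∈p∩q⁺ (v∈R , x∉p⇒x∈∁p v∉Y)
      , λ v∈ → x∈∁p⇒x∉p (proj₂ (x∈p∩q⁻ R _ v∈)) (proj₁ Q.extends (E.added (here refl))))
    sol : Solution Q.state (bound ∣ Y Q.state ∣) η
    -- Since `r` has dropped, `m` may restart at `many`.
    sol = solve r many Q.state (ℕ.≤-pred (ℕ.≤-trans fewer open≤r)) Q-size Q-size

  solve r m {R} S open≤r Y≤m Y≤many with few <? ∣ Y S ∣ | any? (Open? S)
  solve r zero S open≤r Y≤m Y≤many | yes few<Y | _ = contradiction (ℕ.≤-<-trans z≤n few<Y) (ℕ.≤⇒≯ Y≤m)
  solve r (suc m) S open≤r Y≤m Y≤many | yes few<Y | _ = solve-split r m S open≤r Y≤m Y≤many few<Y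
  solve r m {R} S open≤r Y≤m Y≤many | no _ | no none = solve-full S R⊆Y Y≤many
    where
    R⊆Y : ∀ {v} → v ∈ˢ R → v ∈ˢ Y S
    R⊆Y {v} v∈R with v ∈? Y S
    ... | yes v∈Y = v∈Y
    ... | no  v∉Y = contradiction (v , v∈R , v∉Y) none
  solve zero m {R} S open≤r Y≤m Y≤many | no _ | yes (v , v∈R , v∉Y) =
    contradiction open≤r (ℕ.<⇒≱ (ℕ.≤-<-trans z≤n (p⊂q⇒∣p∣<∣q∣ {p = ⊥ˢ}
      ((λ v∈ → contradiction v∈ ∉⊥) , v , x∈p∩q⁺ (v∈R , x∉p⇒x∈∁p v∉Y) , ∉⊥))))
  solve (suc r) m S open≤r Y≤m Y≤many | no few≮Y | yes (v , v∈R , v∉Y) =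
    solve-seal r S v∈R v∉Y open≤r (ℕ.≮⇒≥ few≮Y)

  -- From list assignments to states and back

  module Lists (s>0 : 0 < s) (L : ListAssignment G) (size-L : IsListAssignmentOfSize (s + 1) L) where
    open ListAssignment L

    initial : State ⊤ˢ
    initial = record
      { Y        = ⊥ˢ
      ; avail    = colours
      ; Y⊆R      = λ _ → ∈⊤
      ; unique   = λ v → Unique.tabulate⁺ (proj₁ (proj₂ (size-L v)))
      ; coloured = λ v∈ → contradiction v∈ ∉⊥
      -- Positivity of `s` makes `s + 1` at least two.
      ; choice   = λ {v} _ _ → subst (2 ≤_) (sym (size v)) (ℕ.+-monoˡ-≤ 1 s>0)
      ; light    = λ {v} _ _ _ → ℕ.≤-trans (ℕ.≤-reflexive (trans (ℕ.+-comm 1 s) (sym (size v)))) (ℕ.m≤n+m _ _)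
      ; avoids   = λ _ _ _ u∈ → contradiction u∈ ∉⊥
      }
      where
      -- Lists may be infinite, so each is represented by the `s + 1` colours of its injection.
      colours : Vertex → List ℤ
      colours v = tabulate (proj₁ (size-L v))
      size : ∀ v → length (colours v) ≡ s + 1
      size v = length-tabulate (proj₁ (size-L v))

    open Solution (solve order 0 initial
      (∣p∣≤n (⊤ˢ ∩ ∁ ⊥ˢ)) (ℕ.≤-reflexive (∣⊥∣≡0 order))
      (ℕ.≤-trans (ℕ.≤-reflexive (∣⊥∣≡0 order)) z≤n))

    colouring : IsColoring L colour
    colouring v = let i , eq = ∈-tabulate⁻ (respects {v} ∈⊤) in
      subst (λ a → list v a) (sym eq) (proj₂ (proj₂ (size-L v)) i)

    -- A walk within one colour class cannot leave a closed set, so `C` contains the whole component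
    -- of `u`.
    clustering : HasClustering G colour η
    clustering S (a , (u , u∈S) , S⊆a , S-walk) with cluster {u} ∈⊤
    ... | C , u∈C , (_ , step) , C≤η = ℕ.≤-trans (p⊆q⇒∣p∣≤∣q∣ S⊆C) C≤η
      where
      follow : ∀ {v v′} → v ∈ˢ C → WalkIn (λ v → colour v ≡ a) v v′ → v′ ∈ˢ C
      follow v∈C ε = v∈C
      follow v∈C ((cv , cv′ , adj) ◅ walk) =
        follow (step v∈C ∈⊤ adj (trans cv (sym cv′))) walk
      S⊆C : S ⊆ˢ C
      S⊆C {v} v∈S = follow u∈C (Equivalence.to (S-walk u∈S v) v∈S)

theorem5 : (s t w : ℕ) → .{{_ : NonZero s}} → .{{_ : NonZero t}} → .{{_ : NonZero w}} → ∃[ η ] (NonZero η × ((G : Graph) → Treewidth≤ G w → ¬ (K s t ⊑ G) → ChoosableWithClustering G (s + 1) η))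
theorem5 s t w = η , η-nonZero , λ G (D , width≤w) K⋢G L size-L →
  let open Completion.Lists K⋢G D width≤w (>-nonZero⁻¹ s) L size-L in
  _ , colouring , clustering
  where open Bounds t w
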